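{- (i) $E_2(x)=\tfrac12x(x^3+3x^2-4x-1)+\tfrac14(2x^4-4x^3+29x^2-15x+2)(1-4x)^{ -3/2}-\tfrac14(16x^7-48x^6-76x^5+64x^4+36x^3-21x^2-5x+2)(1-4x^2)^{ -3/2}$. (ii) $O_2(x)=-\tfrac12(x^4+3x^3-5x^2-4x+2)+\tfrac14(2x^4-4x^3+29x^2-15x+2)(1-4x)^{ -3/2}+\tfrac14(16x^7-48x^6-76x^5+64x^4+36x^3-21x^2-5x+2)(1-4x^2)^{ -3/2}$. (iii) $F_2(x)=\tfrac12(x^2+3x-2)+\tfrac12(2x^4-4x^3+29x^2-15x+2)(1-4x)^{ -3/2}$.
   Context: An occurrence of $132$ in $\pi=\pi_1\cdots\pi_n\in\mathfrak S_n$ is a triple $i<j<k$ with $\pi_i<\pi_k<\pi_j$. A permutation is even or odd according to the parity of its number of inversions. $E_2(x)$ is $\sum_{n\ge0}$ (number of even $\pi\in\mathfrak S_n$ with exactly two occurrences of $132$) $x^n$. $O_2(x)$ is the same with odd permutations. $F_2(x)=E_2(x)+O_2(x)$. -}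

module Defs where

open import Data.Nat as ℕ using (ℕ; zero; suc; _∸_; ⌊_/2⌋; _<ᵇ_; _≡ᵇ_)
open import Data.Bool using (Bool; true; false; _∧_; _∨_; not; if_then_else_)
open import Data.Fin using (Fin; toℕ)
open import Data.Vec using (Vec; []; _∷_)
import Data.Vec as Vec
open import Data.List using (List; []; _∷_; length; filterᵇ; map; concatMap; allFin)
open import Data.Integer as ℤ using (ℤ; +_)
open import Data.Rational as ℚ using (ℚ; _+_; _*_; _-_; _/_; 0ℚ; 1ℚ)

-- Permutations of {0,…,n-1}, in one-line notation π₁⋯πₙ, are the
-- vectors of length n over Fin n with pairwise distinct entries.

vecs : (n k : ℕ) → List (Vec (Fin n) k)
vecs n zero    = [] ∷ []
vecs n (suc k) = concatMap (λ i → map (i ∷_) (vecs n k)) (allFin n)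

toℕs : ∀ {n k} → Vec (Fin n) k → List ℕ
toℕs v = Data.List.map toℕ (Vec.toList v)

elemᵇ : ℕ → List ℕ → Bool
elemᵇ a []       = false
elemᵇ a (b ∷ bs) = (a ≡ᵇ b) ∨ elemᵇ a bs

distinct : List ℕ → Bool
distinct []       = true
distinct (a ∷ as) = not (elemᵇ a as) ∧ distinct as

countᵇ : (ℕ → Bool) → List ℕ → ℕ
countᵇ p xs = length (filterᵇ p xs)

inv : List ℕ → ℕ
inv []       = 0
inv (a ∷ as) = countᵇ (λ b → b <ᵇ a) as ℕ.+ inv as

pairs132 : ℕ → List ℕ → ℕ
pairs132 a []       = 0
pairs132 a (b ∷ bs) = countᵇ (λ c → (a <ᵇ c) ∧ (c <ᵇ b)) bs ℕ.+ pairs132 a bs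

occ132 : List ℕ → ℕ
occ132 []       = 0
occ132 (a ∷ as) = pairs132 a as ℕ.+ occ132 as

isEven : ℕ → Bool
isEven zero    = true
isEven (suc n) = not (isEven n)

evenCount : ℕ → ℕ
evenCount n = length (filterᵇ (λ v → let l = toℕs v in
  distinct l ∧ isEven (inv l) ∧ (occ132 l ≡ᵇ 2)) (vecs n n))

oddCount : ℕ → ℕ
oddCount n = length (filterᵇ (λ v → let l = toℕs v in
  distinct l ∧ not (isEven (inv l)) ∧ (occ132 l ≡ᵇ 2)) (vecs n n))

Series : Set
Series = ℕ → ℚ

gf : (ℕ → ℕ) → Series
gf c n = (+ c n) / 1

poly : List ℤ → Series
poly []       n       = 0ℚ
poly (a ∷ as) zero    = a / 1
poly (a ∷ as) (suc n) = poly as n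

_⊕_ : Series → Series → Series
(f ⊕ g) n = f n + g n

scale : ℚ → Series → Series
scale q f n = q * f n

sumTo : (ℕ → ℚ) → ℕ → ℚ
sumTo f zero    = f 0
sumTo f (suc n) = sumTo f n + f (suc n)

_⊛_ : Series → Series → Series
(f ⊛ g) n = sumTo (λ i → f i * g (n ∸ i)) n

_^ℚ_ : ℚ → ℕ → ℚ
q ^ℚ zero    = 1ℚ
q ^ℚ suc k   = (q ^ℚ k) * q

gbinom : ℚ → ℕ → ℚ
gbinom α zero    = 1ℚ
gbinom α (suc k) = gbinom α k * (α - ((+ k) / 1)) * ((+ 1) / suc k)

-- (1 + c x)^α = Σ_k binom(α,k) c^k x^k
binSeries : ℚ → ℚ → Series
binSeries α c k = gbinom α k * (c ^ℚ k)

subSq : Series → Series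
subSq s n = if isEven n then s ⌊ n /2⌋ else 0ℚ

neg : ℕ → ℤ
neg n = ℤ.- (+ n)

A : Series
A = binSeries (neg 3 / 2) (neg 4 / 1)

B : Series
B = subSq A

half : ℚ
half = (+ 1) / 2

quarter : ℚ
quarter = (+ 1) / 4

P : Series
P = poly (+ 2 ∷ neg 15 ∷ + 29 ∷ neg 4 ∷ + 2 ∷ [])

Q : Series
Q = poly (+ 2 ∷ neg 5 ∷ neg 21 ∷ + 36 ∷ + 64 ∷ neg 76 ∷ neg 48 ∷ + 16 ∷ [])

E2rhs : Series
E2rhs = scale half (poly (+ 0 ∷ neg 1 ∷ neg 4 ∷ + 3 ∷ + 1 ∷ []))
      ⊕ (scale quarter (P ⊛ A) ⊕ scale (ℚ.- quarter) (Q ⊛ B))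

O2rhs : Series
O2rhs = scale (ℚ.- half) (poly (+ 2 ∷ neg 4 ∷ neg 5 ∷ + 3 ∷ + 1 ∷ []))
      ⊕ (scale quarter (P ⊛ A) ⊕ scale quarter (Q ⊛ B))

F2rhs : Series
F2rhs = scale half (poly (neg 2 ∷ + 3 ∷ + 1 ∷ []))
      ⊕ scale half (P ⊛ A)

E2 O2 F2 : Series
E2 = gf evenCount
O2 = gf oddCount
F2 = E2 ⊕ O2

{-# OPTIONS --safe #-}
-- Build a permutation from right to left.  A letter c prepended to σ adds c
-- inversions and h(c) occurrences of 132, where h(d) is the number of
-- inversions among the entries ≥ d of σ.  With at most two occurrences left to
-- create, only the length and the positions where h equals 0, 1 or 2 matter.
-- This gives linear recurrences for generating functions indexed by the least
-- zero t of h and the number H of letters above it, with solutions a polynomial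
-- of degree at most 2 in H times C^H, where C = 1 + x C² (for the permutations
-- counted by sign: ⌊H/2⌋ and (1 + b²)^⌊H/2⌋, where b = x (1 + b²)).  Finally
-- 1 - 2 x C = (1 - 4x)^(1/2) and 1 - 2 x b = (1 - 4x²)^(1/2).
module Submission where

open import Defs
open import Algebra.Bundles using (CommutativeRing; RawRing)
open import Algebra.Solver.Ring.AlmostCommutativeRing using (fromCommutativeRing; _-Raw-AlmostCommutative⟶_)
import Algebra.Solver.Ring
open import Data.Bool using (Bool; true; false; _∧_; _∨_; not)
open import Data.Bool.Properties using (∧-zeroʳ; not-involutive)
open import Data.Fin using (Fin; toℕ) renaming (zero to fzero; suc to fsuc)
open import Data.Integer as ℤ using (ℤ)
import Data.Integer.Properties as ℤₚ
open import Data.List using (List; []; _∷_; _++_; length; filterᵇ; map; concatMap; allFin; tabulate)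
open import Data.Maybe using (Maybe; just; nothing)
open import Data.Nat as ℕ using (ℕ; zero; suc; _∸_; _≤_; _<_; z≤n; s≤s; _<ᵇ_; _≡ᵇ_; ⌊_/2⌋)
import Data.Nat.Properties as ℕₚ
open import Data.Product using (_×_; _,_)
open import Data.Sum using (inj₁; inj₂)
open import Data.Vec using ([]; _∷_)
open import Function using (_∘_; id)
open import Level using (0ℓ)
open import Relation.Binary.PropositionalEquality as ≡ using (_≡_)
open import Relation.Nullary using (yes; no)

-- Recurrences and closed forms over a commutative ring

-- The closed forms are verified, not derived: every `z` carries a factor x, so coefficient n + 1 of
-- a solution of `System` follows from coefficients n by induction on H, and any solution is the
-- generating function of extensions. The recurrences are short because the sum over the letters t,
-- ..., t + H is the one for t + 1 and H - 1, plus the term of letter t and a few corrections.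
-- Weighting a letter c by y^c gives E2 + y O2 at y = 1 and y = -1, so one combinatorial argument
-- serves both counts.
--
-- The obstacle is division, since everything is to be decided as polynomial identities. Each value
-- is therefore a polynomial in C or b (and H) times powers of these series and a common factor
-- `M₀`, and only `M₀` hides denominators. Square roots are not constructed separately: if A =
-- U^(-3/2), then A U^2 is U^(1/2), and A^2 U^3 = 1 because x d/dx annihilates the left side.

module RingAlgebra where
  open import Data.Integer using (+_)

  ℤ-raw : RawRing 0ℓ 0ℓ
  ℤ-raw = CommutativeRing.rawRing ℤₚ.+-*-commutativeRing

  -- Equality in R need not be decidable, so the coefficients of normal forms are compared in ℤ and
  -- carried to R by `φ`.
  module IntegerSolver (R : CommutativeRing 0ℓ 0ℓ)
    (φ : ℤ-raw -Raw-AlmostCommutative⟶ fromCommutativeRing R) where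

    open CommutativeRing R hiding (zero)
    open _-Raw-AlmostCommutative⟶_ φ renaming (⟦_⟧ to ⟨_⟩)

    coeff≟ : ∀ a b → Maybe (⟨ a ⟩ ≈ ⟨ b ⟩)
    coeff≟ a b with a ℤ.≟ b
    ... | yes a≡b = just (reflexive (≡.cong ⟨_⟩ a≡b))
    ... | no  _   = nothing

    open Algebra.Solver.Ring ℤ-raw (fromCommutativeRing R) φ coeff≟ public
      using (Polynomial; con; var; _:+_; _:*_; _:-_; :-_; _:^_; _:=_; solve; ⟦_⟧)

    horner : ∀ {n} → List ℤ → Polynomial n → Polynomial n
    horner []       e = con (+ 0)
    horner (a ∷ as) e = con a :+ e :* horner as e

  -- V t H, U t H and Z t H enumerate the extensions by respectively 0, 1 and 2
  -- further occurrences of a permutation of length t + H for which h = 0 from t on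
  -- and h ≥ 1, 2, 3 respectively below t; z t is the weight of the letter t.
  -- U₁ s and U₂ s are the variants of U where h = 1 at s, respectively at s and
  -- s + 1, just below the zeros; γ⁺ s is the gain over Z when h = 1 at s.
  module Families (R : CommutativeRing 0ℓ 0ℓ) (z : ℕ → CommutativeRing.Carrier R)
    (V U Z : ℕ → ℕ → CommutativeRing.Carrier R) where
    open CommutativeRing R

    U₁ U₂ γ⁺ : ℕ → ℕ → Carrier
    U₁ s H = U (1 ℕ.+ s) H + z s * V (2 ℕ.+ s) H
    U₂ s H = U (2 ℕ.+ s) H + (z s * V (3 ℕ.+ s) H + z (suc s) * V (3 ℕ.+ s) H)
    γ⁺ s H = z s * U₂ s H + z (suc s) * (z s * V (2 ℕ.+ s) (suc H))

    -- The letters with h = 0 are t, ..., t + H. Letter t leads to t and H + 1. A later letter leads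
    -- to the state it would reach if the zeros began at t + 1, except that letters t + 1 and t + 2
    -- leave the value 1 or 2 at t; where this value can still be afforded, an extra term arises. In
    -- `Z-1` there is no letter t + 2.
    record System : Set where
      field
        V-0   : ∀ t → V t 0 ≈ 1# + z t * V t 1
        V-suc : ∀ t H → V t (suc H) ≈ V (suc t) H + z t * V t (2 ℕ.+ H)
        U-0   : ∀ t → U t 0 ≈ z t * U t 1
        U-suc : ∀ t H → U t (suc H) ≈ U (suc t) H + z t * U t (2 ℕ.+ H) + z (suc t) * (z t * V (2 ℕ.+ t) (suc H))
        Z-0   : ∀ t → Z t 0 ≈ z t * Z t 1
        Z-1   : ∀ t → Z t 1 ≈ Z (suc t) 0 + z t * Z t 2 + z (suc t) * γ⁺ t 1
        Z-suc : ∀ t H → Z t (2 ℕ.+ H) ≈ Z (suc t) (suc H) + z t * Z t (3 ℕ.+ H) + z (suc t) * γ⁺ t (2 ℕ.+ H)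
                  + z (2 ℕ.+ t) * (z t * V (3 ℕ.+ t) (suc H))

  -- Given z W = E, clearing z from elements with a factor W turns the recurrences
  -- into polynomial identities, within reach of the ring solver.
  module Clearing (R : CommutativeRing 0ℓ 0ℓ) (W : CommutativeRing.Carrier R) where
    open CommutativeRing R
    open import Relation.Binary.Reasoning.Setoid setoid
    open import Algebra.Properties.CommutativeSemigroup *-commutativeSemigroup using (x∙yz≈y∙xz)

    clear-z : ∀ {z E M Y r} → z * W ≈ E → Y ≈ M * W * r → z * Y ≈ M * (E * r)
    clear-z {z} {E} {M} {Y} {r} zW eY = begin
      z * Y             ≈⟨ *-congˡ (trans eY (*-assoc M W r)) ⟩
      z * (M * (W * r)) ≈⟨ x∙yz≈y∙xz z M (W * r) ⟩
      M * (z * (W * r)) ≈⟨ *-congˡ (sym (*-assoc z W r)) ⟩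
      M * (z * W * r)   ≈⟨ *-congˡ (*-congʳ zW) ⟩
      M * (E * r)       ∎

    clear-W : ∀ {W′ M Y r} → W ≈ W′ → Y ≈ M * W * r → Y ≈ M * (W′ * r)
    clear-W {M = M} {r = r} e eY = trans eY (trans (*-assoc M W r) (*-congˡ (*-congʳ e)))

    clear-+ : ∀ {M X Y p q} → X ≈ M * p → Y ≈ M * q → X + Y ≈ M * (p + q)
    clear-+ {M} {p = p} {q} eX eY = trans (+-cong eX eY) (sym (distribˡ M p q))

    -- Three factors W are held in reserve because a term of the recurrences has at most three
    -- factors `z`.
    W³ : Carrier → Carrier
    W³ M = M * W * W * W

    -- Moves the ratio c of consecutive values of M into the polynomial, so that values for
    -- different H share the factor `W³ M`.
    W³-scale : ∀ {M c c′ r} → c ≈ c′ → W³ (M * c) * r ≈ W³ M * (c′ * r)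
    W³-scale {M} {c} {c′} {r} e = begin
      M * c * W * W * W * r     ≈⟨ *-congʳ (*-congʳ (*-congʳ (swap M c W))) ⟩
      M * W * c * W * W * r     ≈⟨ *-congʳ (*-congʳ (swap (M * W) c W)) ⟩
      M * W * W * c * W * r     ≈⟨ *-congʳ (swap (M * W * W) c W) ⟩
      M * W * W * W * c * r     ≈⟨ *-assoc (W³ M) c r ⟩
      M * W * W * W * (c * r)   ≈⟨ *-congˡ (*-congʳ e) ⟩
      M * W * W * W * (c′ * r)  ∎
      where
      swap : ∀ a b c → a * b * c ≈ a * c * b
      swap a b c = trans (*-assoc a b c) (trans (*-congˡ (*-comm b c)) (sym (*-assoc a c b)))

    module _ {M W′ z₀ z₁ z₂ E₀ E₁ E₂ : Carrier} (eW : W ≈ W′) (e₀ : z₀ * W ≈ E₀) (e₁ : z₁ * W ≈ E₁) (e₂ : z₂ * W ≈ E₂) where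

      -- One lemma for each shape of recurrence, named by its degree in the weights. Each factor z
      -- consumes one W; terms of lower degree pay with W′ instead, which makes the last hypothesis
      -- a polynomial identity.
      scaled : ∀ {l b rl rb} → l ≈ W³ M * rl → b ≈ W³ M * rb → W′ * rl ≈ E₀ * rb → l ≈ z₀ * b
      scaled l b eq = trans (clear-W eW l) (trans (*-congˡ eq) (sym (clear-z e₀ b)))

      linear : ∀ {l a b rl ra rb} → l ≈ W³ M * rl → a ≈ W³ M * ra → b ≈ W³ M * rb →
        W′ * rl ≈ W′ * ra + E₀ * rb → l ≈ a + z₀ * b
      linear l a b eq = trans (clear-W eW l) (trans (*-congˡ eq) (sym (clear-+ (clear-W eW a) (clear-z e₀ b))))

      quadratic : ∀ {l a b c rl ra rb rc} → l ≈ W³ M * rl → a ≈ W³ M * ra → b ≈ W³ M * rb → c ≈ W³ M * rc →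
        W′ * (W′ * rl) ≈ W′ * (W′ * ra) + W′ * (E₀ * rb) + E₁ * (E₀ * rc) → l ≈ a + z₀ * b + z₁ * (z₀ * c)
      quadratic l a b c eq = trans (clear-W eW (clear-W eW l)) (trans (*-congˡ eq) (sym
        (clear-+ (clear-+ (clear-W eW (clear-W eW a)) (clear-W eW (clear-z e₀ b))) (clear-z e₁ (clear-z e₀ c)))))

      -- The last summand is `z (suc t) * γ⁺ t` unfolded: c is the U of `U₂`, d is the V occurring
      -- in it, and f is the V in the second half of `γ⁺`.
      cubic : ∀ {l a b c d f rl ra rb rc rd rf} →
        l ≈ W³ M * rl → a ≈ W³ M * ra → b ≈ W³ M * rb → c ≈ W³ M * rc → d ≈ W³ M * rd → f ≈ W³ M * rf →
        W′ * (W′ * (W′ * rl)) ≈ W′ * (W′ * (W′ * ra)) + W′ * (W′ * (E₀ * rb))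
          + E₁ * (E₀ * (W′ * rc + (E₀ * rd + E₁ * rd)) + E₁ * (E₀ * rf)) →
        l ≈ a + z₀ * b + z₁ * (z₀ * (c + (z₀ * d + z₁ * d)) + z₁ * (z₀ * f))
      cubic-rhs : ∀ {a b c d f ra rb rc rd rf} →
        a ≈ W³ M * ra → b ≈ W³ M * rb → c ≈ W³ M * rc → d ≈ W³ M * rd → f ≈ W³ M * rf →
        a + z₀ * b + z₁ * (z₀ * (c + (z₀ * d + z₁ * d)) + z₁ * (z₀ * f)) ≈
        M * (W′ * (W′ * (W′ * ra)) + W′ * (W′ * (E₀ * rb))
          + E₁ * (E₀ * (W′ * rc + (E₀ * rd + E₁ * rd)) + E₁ * (E₀ * rf)))
      cubic-rhs a b c d f = clear-+
        (clear-+ (clear-W eW (clear-W eW (clear-W eW a))) (clear-W eW (clear-W eW (clear-z e₀ b))))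
        (clear-z e₁ (clear-+
          (clear-z e₀ (clear-+ (clear-W eW c) (clear-+ (clear-z e₀ d) (clear-z e₁ d))))
          (clear-z e₁ (clear-z e₀ f))))
      cubic l a b c d f eq = trans (clear-W eW (clear-W eW (clear-W eW l))) (trans (*-congˡ eq) (sym (cubic-rhs a b c d f)))

      cubic′ : ∀ {l a b c d f g rl ra rb rc rd rf rg} →
        l ≈ W³ M * rl → a ≈ W³ M * ra → b ≈ W³ M * rb → c ≈ W³ M * rc → d ≈ W³ M * rd → f ≈ W³ M * rf → g ≈ W³ M * rg →
        W′ * (W′ * (W′ * rl)) ≈ W′ * (W′ * (W′ * ra)) + W′ * (W′ * (E₀ * rb))
          + E₁ * (E₀ * (W′ * rc + (E₀ * rd + E₁ * rd)) + E₁ * (E₀ * rf)) + W′ * (E₂ * (E₀ * rg)) →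
        l ≈ a + z₀ * b + z₁ * (z₀ * (c + (z₀ * d + z₁ * d)) + z₁ * (z₀ * f)) + z₂ * (z₀ * g)
      cubic′ l a b c d f g eq = trans (clear-W eW (clear-W eW (clear-W eW l))) (trans (*-congˡ eq) (sym
        (clear-+ (cubic-rhs a b c d f) (clear-W eW (clear-z e₂ (clear-z e₀ g))))))

  module PolynomialForms (R : CommutativeRing 0ℓ 0ℓ)
    (φ : ℤ-raw -Raw-AlmostCommutative⟶ fromCommutativeRing R) where
    open CommutativeRing R using (Carrier)
    open IntegerSolver R φ

    -- A formula generic in the number of variables can be evaluated at ring elements by `eval` and
    -- also inserted in solver goals; the two readings agree by computation.
    Form : Set
    Form = ∀ {n} → Polynomial n → Polynomial n → Polynomial n

    eval : Form → Carrier → Carrier → Carrier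
    eval r a b = ⟦ r (var fzero) (var (fsuc fzero)) ⟧ (a ∷ b ∷ [])

  -- Closed forms for the count of all permutations

  module UnsignedSystem (R : CommutativeRing 0ℓ 0ℓ)
    (φ : ℤ-raw -Raw-AlmostCommutative⟶ fromCommutativeRing R) where
    open CommutativeRing R hiding (zero)
    open IntegerSolver R φ
    open PolynomialForms R φ
    open _-Raw-AlmostCommutative⟶_ φ renaming (⟦_⟧ to ⟨_⟩)

    s r c³ : ∀ {n} → Polynomial n → Polynomial n
    s c = con (+ 2) :- c
    r c = c :- con (+ 1)
    c³ c = c :* c :* c

    -- The factor 1 / (2 (2 - C)³ C⁵) is left to W³ M₀.  Then V t H = C^(H+1), and U, Z
    -- are C^H times polynomials in H, found by undetermined coefficients from
    -- x = (C - 1) / C² and √(1 - 4x) = (2 - C) / C.  Z t 0 is exceptional because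
    -- Z-1 lacks the last term of Z-suc.
    one vf uf zf z₀f : Form
    one c h = con (+ 2) :* c³ c :* c :* c :* c³ (s c)
    vf c h = con (+ 2) :* c³ c :* c³ c :* c³ (s c)
    uf c h = con (+ 2) :* c³ c :* s c :* s c :* r c :* r c :* (h :+ r c)
    zf c h = α :+ h :* (β :+ h :* γ)
      where
      γ = r c :* r c :* r c :* r c :* s c
      β = r c :* r c :* (r c :* r c :* c :+ con (+ 2) :* c³ (r c) :* s c
            :+ con (+ 4) :* r c :* c :* s c :* s c :+ con (+ 2) :* r c :* c :* c :* s c :* s c :+ con (+ 2) :* c :* c :* s c :* s c)
      α = r c :* (β :+ γ) :- con (+ 2) :* r c :* r c :* c³ c :* c³ (s c)
    z₀f c h = zf c (con (+ 0)) :+ con (+ 2) :* r c :* r c :* c :* c :* c³ (s c)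

    module _ (C : Carrier) (z : ℕ → Carrier) (zC : ∀ t → z t * (C * C) ≈ C - ⟨ + 1 ⟩)
      (M₀ : Carrier) (M₀≈ : 1# ≈ Clearing.W³ R (C * C) M₀ * eval one C ⟨ + 0 ⟩) where

      open Clearing R (C * C)

      -- Built from `⟨ + 1 ⟩` so that `nat (suc H)` is the value of `con (+ 1) :+ h`.
      nat : ℕ → Carrier
      nat zero    = ⟨ + 0 ⟩
      nat (suc H) = ⟨ + 1 ⟩ + nat H

      M : ℕ → Carrier
      M zero    = M₀
      M (suc H) = M H * C

      V U Z : ℕ → ℕ → Carrier
      V t H       = W³ (M H) * eval vf C (nat H)
      U t H       = W³ (M H) * eval uf C (nat H)
      Z t zero    = W³ M₀ * eval z₀f C ⟨ + 0 ⟩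
      Z t (suc H) = W³ (M (suc H)) * eval zf C (nat (suc H))

      up : ∀ {M r} → W³ (M * C) * r ≈ W³ M * (C * r)
      up = W³-scale refl

      up² : ∀ {M r} → W³ (M * C * C) * r ≈ W³ M * (C * (C * r))
      up² = trans up up

      up³ : ∀ {M r} → W³ (M * C * C * C) * r ≈ W³ M * (C * (C * (C * r)))
      up³ = trans up² up

      open Families R z V U Z

      W : ∀ {n} → Polynomial n → Polynomial n
      W c = c :* c

      system : System
      system = record
        { V-0   = λ t → linear refl (zC t) (zC t) (zC t) refl M₀≈ up
                    (solve 1 (λ c → W c :* vf c (con (+ 0)) := W c :* one c (con (+ 0)) :+ r c :* (c :* vf c (con (+ 0)))) refl C)
        ; V-suc = λ t H → linear refl (zC t) (zC t) (zC t) up refl up²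
                    (solve 1 (λ c → W c :* (c :* vf c c) := W c :* vf c c :+ r c :* (c :* (c :* vf c c))) refl C)
        ; U-0   = λ t → scaled refl (zC t) (zC t) (zC t) refl up
                    (solve 1 (λ c → W c :* uf c (con (+ 0)) := r c :* (c :* uf c (con (+ 1) :+ con (+ 0)))) refl C)
        ; U-suc = λ t H → quadratic refl (zC t) (zC (suc t)) (zC t) up refl up² up
                    (solve 2 (λ c h → W c :* (W c :* (c :* uf c (con (+ 1) :+ h))) := W c :* (W c :* uf c h)
                      :+ W c :* (r c :* (c :* (c :* uf c (con (+ 1) :+ (con (+ 1) :+ h))))) :+ r c :* (r c :* (c :* vf c h))) refl C (nat H))
        ; Z-0   = λ t → scaled refl (zC t) (zC t) (zC t) refl up
                    (solve 1 (λ c → W c :* z₀f c (con (+ 0)) := r c :* (c :* zf c (con (+ 1) :+ con (+ 0)))) refl C)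
        ; Z-1   = λ t → cubic refl (zC t) (zC (suc t)) (zC t) up refl up² up up up²
                    (solve 1 (λ c → let h = con (+ 0); h₁ = con (+ 1) :+ h; h₂ = con (+ 1) :+ h₁ in
                      W c :* (W c :* (W c :* (c :* zf c h₁))) :=
                      W c :* (W c :* (W c :* z₀f c h)) :+ W c :* (W c :* (r c :* (c :* (c :* zf c h₂))))
                        :+ r c :* (r c :* (W c :* (c :* uf c h₁) :+ (r c :* (c :* vf c h) :+ r c :* (c :* vf c h))) :+ r c :* (r c :* (c :* (c :* vf c h))))) refl C)
        ; Z-suc = λ t H → cubic′ refl (zC t) (zC (suc t)) (zC (2 ℕ.+ t)) up² up up³ up² up² up³ up
                    (solve 2 (λ c h → let h₁ = con (+ 1) :+ h; h₂ = con (+ 1) :+ h₁; h₃ = con (+ 1) :+ h₂ in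
                      W c :* (W c :* (W c :* (c :* (c :* zf c h₂)))) :=
                      W c :* (W c :* (W c :* (c :* zf c h₁))) :+ W c :* (W c :* (r c :* (c :* (c :* (c :* zf c h₃)))))
                        :+ r c :* (r c :* (W c :* (c :* (c :* uf c h₂)) :+ (r c :* (c :* (c :* vf c h)) :+ r c :* (c :* (c :* vf c h)))) :+ r c :* (r c :* (c :* (c :* (c :* vf c h)))))
                        :+ W c :* (r c :* (r c :* (c :* vf c h)))) refl C (nat H))
        }

  -- Closed forms for the count by sign

  module SignedSystem (R : CommutativeRing 0ℓ 0ℓ)
    (φ : ℤ-raw -Raw-AlmostCommutative⟶ fromCommutativeRing R) where
    open CommutativeRing R hiding (zero)
    open IntegerSolver R φ
    open PolynomialForms R φ
    open _-Raw-AlmostCommutative⟶_ φ renaming (⟦_⟧ to ⟨_⟩)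

    w v : ∀ {n} → Polynomial n → Polynomial n
    w e = con (+ 1) :+ e :* e
    v e = con (+ 1) :- e :* e

    -- The factor 1 / ((1 + b²)⁴ (1 - b²)³) is left to W³ M₀, and e = ± b according to
    -- the parity of t.  The indices 0 and 1 stand for H = 2k and H = 2k + 1, with a
    -- factor (1 + b²)^k omitted; zφ gives the exceptional value Z t 0.
    one v₀ v₁ u₀ u₁ z₀ z₁ zφ : Form
    one e k = w e :* w e :* w e :* w e :* v e :* v e :* v e
    v₀ e k = one e k :* (con (+ 1) :+ e)
    v₁ e k = w e :* one e k
    u₀ e k = w e :* w e :* v e :* v e :* (horner (+ 0 ∷ + 0 ∷ + 0 ∷ neg 1 ∷ neg 1 ∷ neg 3 ∷ + 1 ∷ []) e
              :+ k :* (w e :* horner (+ 0 ∷ + 0 ∷ neg 2 ∷ neg 2 ∷ []) e))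
    u₁ e k = w e :* w e :* w e :* v e :* v e :* (horner (+ 0 ∷ + 0 ∷ neg 1 ∷ neg 1 ∷ neg 3 ∷ + 1 ∷ []) e
              :+ k :* (w e :* horner (+ 0 ∷ + 0 ∷ neg 2 ∷ []) e))
    z₀ e k = horner (+ 0 ∷ + 0 ∷ neg 1 ∷ neg 1 ∷ + 3 ∷ + 6 ∷ + 3 ∷ + 12 ∷ neg 7 ∷ + 0 ∷ neg 4 ∷ neg 7 ∷ + 8 ∷ + 6 ∷ neg 2 ∷ []) e
      :+ k :* (w e :* horner (+ 0 ∷ + 0 ∷ + 2 ∷ + 2 ∷ + 1 ∷ + 3 ∷ + 4 ∷ + 6 ∷ neg 3 ∷ neg 5 ∷ + 4 ∷ + 2 ∷ []) e
      :+ k :* (w e :* w e :* v e :* horner (+ 0 ∷ + 0 ∷ + 0 ∷ + 0 ∷ + 2 ∷ + 2 ∷ []) e))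
    z₁ e k = w e :* (horner (+ 0 ∷ + 0 ∷ + 0 ∷ + 2 ∷ + 5 ∷ + 1 ∷ + 10 ∷ neg 5 ∷ + 2 ∷ neg 3 ∷ neg 6 ∷ + 7 ∷ + 5 ∷ neg 2 ∷ []) e
      :+ k :* (w e :* horner (+ 0 ∷ + 0 ∷ + 2 ∷ + 0 ∷ + 3 ∷ + 2 ∷ + 6 ∷ neg 4 ∷ neg 5 ∷ + 2 ∷ + 2 ∷ []) e
      :+ k :* (w e :* w e :* v e :* horner (+ 0 ∷ + 0 ∷ + 0 ∷ + 0 ∷ + 2 ∷ []) e)))
    zφ e k = horner (+ 0 ∷ + 0 ∷ + 0 ∷ + 0 ∷ + 2 ∷ + 5 ∷ + 1 ∷ + 10 ∷ neg 5 ∷ + 2 ∷ neg 3 ∷ neg 6 ∷ + 7 ∷ + 5 ∷ neg 2 ∷ []) e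

    sign : ℕ → Carrier → Carrier
    sign zero    b = b
    sign (suc t) b = - sign t b

    module _ (b : Carrier) (z : ℕ → Carrier) (zW : ∀ t → z t * (⟨ + 1 ⟩ + b * b) ≈ sign t b)
      (M₀ : Carrier) (M₀≈ : 1# ≈ Clearing.W³ R (⟨ + 1 ⟩ + b * b) M₀ * eval one b ⟨ + 0 ⟩) where

      W = ⟨ + 1 ⟩ + b * b
      open Clearing R W

      -- With M and k as parameters, recursion by two reduces a recurrence for all H to H = 0 and H
      -- = 1: two more letters only replace M by M W and k by 1 + k.
      alternate : Form → Form → Carrier → Carrier → Carrier → ℕ → Carrier
      alternate p q e M k zero          = W³ M * eval p e k
      alternate p q e M k (suc zero)    = W³ M * eval q e k
      alternate p q e M k (suc (suc H)) = alternate p q e (M * W) (⟨ + 1 ⟩ + k) H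

      V U Z : ℕ → ℕ → Carrier
      V t H       = alternate v₀ v₁ (sign t b) M₀ ⟨ + 0 ⟩ H
      U t H       = alternate u₀ u₁ (sign t b) M₀ ⟨ + 0 ⟩ H
      Z t zero    = W³ M₀ * eval zφ (sign t b) ⟨ + 0 ⟩
      Z t (suc H) = alternate z₀ z₁ (sign t b) M₀ ⟨ + 0 ⟩ (suc H)

      W-sign : ∀ t → W ≈ ⟨ + 1 ⟩ + sign t b * sign t b
      W-sign zero    = refl
      W-sign (suc t) = trans (W-sign t) (solve 1 (λ e → w e := w (:- e)) refl (sign t b))

      -- `one` depends on e only through e^2, so the normalization of `M₀` does not see the sign.
      M₀-sign : ∀ t → 1# ≈ W³ M₀ * eval one (sign t b) ⟨ + 0 ⟩
      M₀-sign zero    = M₀≈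
      M₀-sign (suc t) = trans (M₀-sign t) (*-congˡ (solve 1 (λ e → one e (con (+ 0)) := one (:- e) (con (+ 0))) refl (sign t b)))

      -- `sign (suc t) b` unfolds to `- sign t b`, so the shifts of t become iterated negations of a
      -- single element e, and the recurrences become identities in e and k.
      module Recurrences {e z₀′ z₁′ z₂′ : Carrier} (eW : W ≈ ⟨ + 1 ⟩ + e * e)
        (e₀ : z₀′ * W ≈ e) (e₁ : z₁′ * W ≈ - e) (e₂ : z₂′ * W ≈ - - e) where

        up : ∀ {M r} → W³ (M * W) * r ≈ W³ M * ((⟨ + 1 ⟩ + e * e) * r)
        up = W³-scale eW

        up² : ∀ {M r} → W³ (M * W * W) * r ≈ W³ M * ((⟨ + 1 ⟩ + e * e) * ((⟨ + 1 ⟩ + e * e) * r))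
        up² = trans up up

        V-rec : ∀ M k H → alternate v₀ v₁ e M k (suc H) ≈ alternate v₀ v₁ (- e) M k H + z₀′ * alternate v₀ v₁ e M k (2 ℕ.+ H)
        V-rec M k zero          = linear eW e₀ e₁ e₂ refl refl up
          (solve 2 (λ e k → w e :* v₁ e k := w e :* v₀ (:- e) k :+ e :* (w e :* v₀ e (con (+ 1) :+ k))) refl e k)
        V-rec M k (suc zero)    = linear eW e₀ e₁ e₂ up refl up
          (solve 2 (λ e k → w e :* (w e :* v₀ e (con (+ 1) :+ k)) := w e :* v₁ (:- e) k :+ e :* (w e :* v₁ e (con (+ 1) :+ k))) refl e k)
        V-rec M k (suc (suc H)) = V-rec (M * W) (⟨ + 1 ⟩ + k) H

        U-rec : ∀ M k H → alternate u₀ u₁ e M k (suc H) ≈ alternate u₀ u₁ (- e) M k H + z₀′ * alternate u₀ u₁ e M k (2 ℕ.+ H)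
          + z₁′ * (z₀′ * alternate v₀ v₁ (- - e) M k (suc H))
        U-rec M k zero          = quadratic eW e₀ e₁ e₂ refl refl up refl
          (solve 2 (λ e k → w e :* (w e :* u₁ e k) := w e :* (w e :* u₀ (:- e) k) :+ w e :* (e :* (w e :* u₀ e (con (+ 1) :+ k)))
            :+ (:- e) :* (e :* v₁ (:- :- e) k)) refl e k)
        U-rec M k (suc zero)    = quadratic eW e₀ e₁ e₂ up refl up up
          (solve 2 (λ e k → let k₁ = con (+ 1) :+ k in
            w e :* (w e :* (w e :* u₀ e k₁)) := w e :* (w e :* u₁ (:- e) k) :+ w e :* (e :* (w e :* u₁ e k₁))
            :+ (:- e) :* (e :* (w e :* v₀ (:- :- e) k₁))) refl e k)
        U-rec M k (suc (suc H)) = U-rec (M * W) (⟨ + 1 ⟩ + k) H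

        Z-rec : ∀ M k H → alternate z₀ z₁ e M k (2 ℕ.+ H) ≈ alternate z₀ z₁ (- e) M k (suc H) + z₀′ * alternate z₀ z₁ e M k (3 ℕ.+ H)
          + z₁′ * (z₀′ * (alternate u₀ u₁ (- - e) M k (2 ℕ.+ H)
                     + (z₀′ * alternate v₀ v₁ (- - - e) M k (2 ℕ.+ H) + z₁′ * alternate v₀ v₁ (- - - e) M k (2 ℕ.+ H)))
              + z₁′ * (z₀′ * alternate v₀ v₁ (- - e) M k (3 ℕ.+ H)))
          + z₂′ * (z₀′ * alternate v₀ v₁ (- - - e) M k (suc H))
        Z-rec M k zero          = cubic′ eW e₀ e₁ e₂ up refl up up up up refl
          (solve 2 (λ e k → let k₁ = con (+ 1) :+ k; e₂ = :- :- e; e₃ = :- e₂ in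
            w e :* (w e :* (w e :* (w e :* z₀ e k₁))) :=
            w e :* (w e :* (w e :* z₁ (:- e) k)) :+ w e :* (w e :* (e :* (w e :* z₁ e k₁)))
            :+ (:- e) :* (e :* (w e :* (w e :* u₀ e₂ k₁) :+ (e :* (w e :* v₀ e₃ k₁) :+ (:- e) :* (w e :* v₀ e₃ k₁)))
                          :+ (:- e) :* (e :* (w e :* v₁ e₂ k₁)))
            :+ w e :* (e₂ :* (e :* v₁ e₃ k))) refl e k)
        Z-rec M k (suc zero)    = cubic′ eW e₀ e₁ e₂ up up up² up up up² up
          (solve 2 (λ e k → let k₁ = con (+ 1) :+ k; k₂ = con (+ 1) :+ k₁; e₂ = :- :- e; e₃ = :- e₂ in
            w e :* (w e :* (w e :* (w e :* z₁ e k₁))) :=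
            w e :* (w e :* (w e :* (w e :* z₀ (:- e) k₁))) :+ w e :* (w e :* (e :* (w e :* (w e :* z₀ e k₂))))
            :+ (:- e) :* (e :* (w e :* (w e :* u₁ e₂ k₁) :+ (e :* (w e :* v₁ e₃ k₁) :+ (:- e) :* (w e :* v₁ e₃ k₁)))
                          :+ (:- e) :* (e :* (w e :* (w e :* v₀ e₂ k₂))))
            :+ w e :* (e₂ :* (e :* (w e :* v₀ e₃ k₁)))) refl e k)
        Z-rec M k (suc (suc H)) = Z-rec (M * W) (⟨ + 1 ⟩ + k) H

      open Families R z V U Z

      system : System
      system = record
        { V-0   = λ t → linear (W-sign t) (zW t) (zW t) (zW t) refl (M₀-sign t) refl
                    (solve 1 (λ e → let k = con (+ 0) in w e :* v₀ e k := w e :* one e k :+ e :* v₁ e k) refl (sign t b))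
        ; V-suc = λ t H → V-rec t M₀ ⟨ + 0 ⟩ H
        ; U-0   = λ t → scaled (W-sign t) (zW t) (zW t) (zW t) refl refl
                    (solve 1 (λ e → let k = con (+ 0) in w e :* u₀ e k := e :* u₁ e k) refl (sign t b))
        ; U-suc = λ t H → U-rec t M₀ ⟨ + 0 ⟩ H
        ; Z-0   = λ t → scaled (W-sign t) (zW t) (zW t) (zW t) refl refl
                    (solve 1 (λ e → let k = con (+ 0) in w e :* zφ e k := e :* z₁ e k) refl (sign t b))
        ; Z-1   = λ t → cubic (W-sign t) (zW t) (zW (suc t)) (zW t) refl refl (W³-scale (W-sign t)) refl refl (W³-scale (W-sign t))
          (solve 1 (λ e → let k = con (+ 0); k₁ = con (+ 1) :+ k; e₂ = :- :- e; e₃ = :- e₂ in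
            w e :* (w e :* (w e :* z₁ e k)) :=
            w e :* (w e :* (w e :* zφ (:- e) k)) :+ w e :* (w e :* (e :* (w e :* z₀ e k₁)))
            :+ (:- e) :* (e :* (w e :* u₁ e₂ k :+ (e :* v₁ e₃ k :+ (:- e) :* v₁ e₃ k))
                          :+ (:- e) :* (e :* (w e :* v₀ e₂ k₁)))) refl (sign t b))
        ; Z-suc = λ t H → Z-rec t M₀ ⟨ + 0 ⟩ H
        }
        where
        open module Rec (t : ℕ) = Recurrences {e = sign t b} (W-sign t) (zW t) (zW (suc t)) (zW (suc (suc t)))

  -- Square roots, quadratic equations and elimination of x

  module ClosedForms (R : CommutativeRing 0ℓ 0ℓ)
    (φ : ℤ-raw -Raw-AlmostCommutative⟶ fromCommutativeRing R) where
    open CommutativeRing R hiding (zero)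
    open IntegerSolver R φ
    open PolynomialForms R φ
    open _-Raw-AlmostCommutative⟶_ φ renaming (⟦_⟧ to ⟨_⟩)
    open import Algebra.Properties.Semiring.Exp semiring using (_^_)
    open import Algebra.Properties.AbelianGroup +-abelianGroup using () renaming (x≈y⇒x∙y⁻¹≈ε to x≈y⇒x-y≈0; x∙y⁻¹≈ε⇒x≈y to x-y≈0⇒x≈y)
    open import Relation.Binary.Reasoning.Setoid setoid

    ^-one : ∀ {a} → a ≈ 1# → ∀ n → a ^ n ≈ 1#
    ^-one e zero    = refl
    ^-one e (suc n) = trans (*-cong e (^-one e n)) (*-identityˡ 1#)

    -- If A = U^(-3/2), then A² U³ is annihilated by every derivation.
    derivation-root : (θ : Carrier → Carrier) → (∀ f g → θ (f * g) ≈ θ f * g + f * θ g) → ∀ A U →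
      ⟨ + 2 ⟩ * (U * θ A) + ⟨ + 3 ⟩ * (θ U * A) ≈ 0# → θ (A * A * (U * (U * U))) ≈ 0#
    derivation-root θ θ-* A U ode = begin
      θ (A * A * (U * (U * U)))
        ≈⟨ trans (θ-* _ _) (+-cong (*-congʳ (θ-* A A)) (*-congˡ (trans (θ-* U (U * U)) (+-congˡ (*-congˡ (θ-* U U)))))) ⟩
      (θ A * A + A * θ A) * (U * (U * U)) + A * A * (θ U * (U * U) + U * (θ U * U + U * θ U))
        ≈⟨ solve 4 (λ a u a′ u′ → (a′ :* a :+ a :* a′) :* (u :* (u :* u)) :+ a :* a :* (u′ :* (u :* u) :+ u :* (u′ :* u :+ u :* u′))
              := a :* (u :* u) :* (con (+ 2) :* (u :* a′) :+ con (+ 3) :* (u′ :* a))) refl A U (θ A) (θ U) ⟩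
      A * (U * U) * (⟨ + 2 ⟩ * (U * θ A) + ⟨ + 3 ⟩ * (θ U * A))
        ≈⟨ trans (*-congˡ ode) (zeroʳ _) ⟩
      0# ∎

    -- If U = 1 - 4y and θ y = j y, the equation 2 U θA = -3 θU A satisfied by U^(-3/2) becomes θA =
    -- y (4 θA + 6 j A), the form that a recurrence for the coefficients of A provides.
    ode : ∀ {y U A U′ A′ j} → U ≈ ⟨ + 1 ⟩ - ⟨ + 4 ⟩ * y → U′ ≈ - (⟨ + 4 ⟩ * (j * y)) → A′ ≈ y * (⟨ + 4 ⟩ * A′ + ⟨ + 6 ⟩ * j * A) →
      ⟨ + 2 ⟩ * (U * A′) + ⟨ + 3 ⟩ * (U′ * A) ≈ 0#
    ode {y} {U} {A} {U′} {A′} {j} eU eU′ eA′ = begin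
      ⟨ + 2 ⟩ * (U * A′) + ⟨ + 3 ⟩ * (U′ * A)
        ≈⟨ +-cong (*-congˡ (*-congʳ eU)) (*-congˡ (*-congʳ eU′)) ⟩
      ⟨ + 2 ⟩ * ((⟨ + 1 ⟩ - ⟨ + 4 ⟩ * y) * A′) + ⟨ + 3 ⟩ * (- (⟨ + 4 ⟩ * (j * y)) * A)
        ≈⟨ solve 4 (λ y a a′ j → con (+ 2) :* ((con (+ 1) :- con (+ 4) :* y) :* a′) :+ con (+ 3) :* (:- (con (+ 4) :* (j :* y)) :* a)
              := con (+ 2) :* (a′ :- y :* (con (+ 4) :* a′ :+ con (+ 6) :* j :* a))) refl y A A′ j ⟩
      ⟨ + 2 ⟩ * (A′ - y * (⟨ + 4 ⟩ * A′ + ⟨ + 6 ⟩ * j * A))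
        ≈⟨ trans (*-congˡ (x≈y⇒x-y≈0 eA′)) (zeroʳ _) ⟩
      0# ∎

    -- The square of A U^2 is A^2 U^3 times U.
    square-root : ∀ {A U} → A * A * (U * (U * U)) ≈ 1# → (A * (U * U)) * (A * (U * U)) ≈ U
    square-root {A} {U} e = trans
      (solve 2 (λ a u → (a :* (u :* u)) :* (a :* (u :* u)) := a :* a :* (u :* (u :* u)) :* u) refl A U)
      (trans (*-congʳ e) (*-identityˡ U))

    -- The left side is (A^2 U^3)^2; so A is the inverse cube of the root A U^2.
    cube-inverse : ∀ {A U} → A * A * (U * (U * U)) ≈ 1# → A * ((A * (U * U)) * ((A * (U * U)) * (A * (U * U)))) ≈ 1#
    cube-inverse {A} {U} e = trans
      (solve 2 (λ a u → a :* ((a :* (u :* u)) :* ((a :* (u :* u)) :* (a :* (u :* u))))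
         := a :* a :* (u :* (u :* u)) :* (a :* a :* (u :* (u :* u)))) refl A U)
      (trans (*-cong e e) (*-identityˡ 1#))

    evalPoly : List ℤ → Carrier → Carrier
    evalPoly []       x = 0#
    evalPoly (a ∷ as) x = ⟨ a ⟩ + x * evalPoly as x

    -- Substitution of x = E / W without division: a polynomial of degree n in x, times an element
    -- with n spare factors W, becomes a homogeneous form in E and W.
    module Homogenization (W E x : Carrier) (xW : x * W ≈ E) where
      open Clearing R W

      raise : Carrier → ℕ → Carrier
      raise M zero    = M
      raise M (suc n) = raise (M * W) n

      homogenize : List ℤ → Carrier → Carrier
      homogenize []       r = ⟨ + 0 ⟩
      homogenize (a ∷ as) r = ⟨ a ⟩ * (W ^ length as * r) + E * homogenize as r

      clear-raise : ∀ n {M Y r} → Y ≈ raise M n * r → Y ≈ M * (W ^ n * r)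
      clear-raise zero    e = trans e (*-congˡ (sym (*-identityˡ _)))
      clear-raise (suc n) {M} {Y} {r} e = trans (clear-W refl (clear-raise n e)) (*-congˡ (sym (*-assoc W (W ^ n) r)))

      homogenize-correct : ∀ a as {M Y r} → Y ≈ raise M (length as) * r → evalPoly (a ∷ as) x * Y ≈ M * homogenize (a ∷ as) r
      homogenize-correct a as {M} {Y} {r} e = begin
        (⟨ a ⟩ + x * evalPoly as x) * Y         ≈⟨ solve 4 (λ a x p y → (a :+ x :* p) :* y := a :* y :+ x :* (p :* y)) refl ⟨ a ⟩ x (evalPoly as x) Y ⟩
        ⟨ a ⟩ * Y + x * (evalPoly as x * Y)     ≈⟨ +-cong (*-congˡ (clear-raise (length as) e)) (rest as e) ⟩
        ⟨ a ⟩ * (M * (W ^ length as * r)) + M * (E * homogenize as r)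
          ≈⟨ solve 4 (λ a m p q → a :* (m :* p) :+ m :* q := m :* (a :* p :+ q)) refl ⟨ a ⟩ M (W ^ length as * r) (E * homogenize as r) ⟩
        M * homogenize (a ∷ as) r               ∎
        where
        rest : ∀ as → Y ≈ raise M (length as) * r → x * (evalPoly as x * Y) ≈ M * (E * homogenize as r)
        rest []       e = trans (*-congˡ (zeroˡ Y)) (trans (zeroʳ x) (sym (trans (*-congˡ (trans (*-congˡ 0-homo) (zeroʳ E))) (zeroʳ M))))
        rest (b ∷ bs) e = clear-z xW (homogenize-correct b bs e)

    -- The solver expression whose value is `homogenize`.
    homog : ∀ {n} → Polynomial n → Polynomial n → List ℤ → Polynomial n → Polynomial n
    homog W E []       r = con (+ 0)
    homog W E (a ∷ as) r = con a :* (W :^ length as :* r) :+ E :* homog W E as r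

    1-4 : Carrier → Carrier
    1-4 y = ⟨ + 1 ⟩ - ⟨ + 4 ⟩ * y

    module UnsignedRoot {x A C h : Carrier}
      (root : A * A * (1-4 x * (1-4 x * 1-4 x)) ≈ 1#) (half : ⟨ + 2 ⟩ * h ≈ 1#)
      (eS : ⟨ + 1 ⟩ - ⟨ + 2 ⟩ * (x * C) ≈ A * (1-4 x * 1-4 x))
      (cancel : ∀ f → ⟨ + 4 ⟩ * (x * f) ≈ 0# → f ≈ 0#) where

      private
        U = 1-4 x
        S = A * (U * U)
        D = ⟨ + 1 ⟩ - x * C

      -- By `eS`, 1 - 2xC is a square root of 1 - 4x. Expanding its square leaves 4x times the
      -- equation, and `cancel` removes that factor.
      quadratic-C : x * (C * C) ≈ C - ⟨ + 1 ⟩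
      quadratic-C = sym (x-y≈0⇒x≈y _ _ (cancel _ (begin
        ⟨ + 4 ⟩ * (x * (C - ⟨ + 1 ⟩ - x * (C * C)))
          ≈⟨ solve 2 (λ x c → con (+ 4) :* (x :* (c :- con (+ 1) :- x :* (c :* c))) :=
                (con (+ 1) :- con (+ 4) :* x) :- (con (+ 1) :- con (+ 2) :* (x :* c)) :* (con (+ 1) :- con (+ 2) :* (x :* c))) refl x C ⟩
        U - (⟨ + 1 ⟩ - ⟨ + 2 ⟩ * (x * C)) * (⟨ + 1 ⟩ - ⟨ + 2 ⟩ * (x * C))
          ≈⟨ +-congˡ (-‿cong (trans (*-cong eS eS) (square-root root))) ⟩
        U - U ≈⟨ -‿inverseʳ U ⟩
        0# ∎)))

      -- 1 - xC inverts C and so supplies the negative powers of C.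
      D*C : D * C ≈ 1#
      D*C = begin
        D * C                  ≈⟨ solve 2 (λ x c → (con (+ 1) :- x :* c) :* c := c :- x :* (c :* c)) refl x C ⟩
        C - x * (C * C)        ≈⟨ +-congˡ (-‿cong quadratic-C) ⟩
        C - (C - ⟨ + 1 ⟩)      ≈⟨ solve 1 (λ c → c :- (c :- con (+ 1)) := con (+ 1)) refl C ⟩
        ⟨ + 1 ⟩                ≈⟨ 1-homo ⟩
        1#                     ∎

      D*s : D * (⟨ + 2 ⟩ - C) ≈ S
      D*s = begin
        D * (⟨ + 2 ⟩ - C)      ≈⟨ solve 2 (λ x c → (con (+ 1) :- x :* c) :* (con (+ 2) :- c) := con (+ 2) :- c :- con (+ 2) :* (x :* c) :+ x :* (c :* c)) refl x C ⟩
        ⟨ + 2 ⟩ - C - ⟨ + 2 ⟩ * (x * C) + x * (C * C) ≈⟨ +-congˡ quadratic-C ⟩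
        ⟨ + 2 ⟩ - C - ⟨ + 2 ⟩ * (x * C) + (C - ⟨ + 1 ⟩) ≈⟨ solve 2 (λ x c → con (+ 2) :- c :- con (+ 2) :* (x :* c) :+ (c :- con (+ 1)) := con (+ 1) :- con (+ 2) :* (x :* c)) refl x C ⟩
        ⟨ + 1 ⟩ - ⟨ + 2 ⟩ * (x * C) ≈⟨ eS ⟩
        S                      ∎

      -- The inverse of 2 (2 - C)^3 C^11, where C^11 is C^5 times the six factors C of `W³`. Since 2
      -- - C = C S, the cube contributes A = S^(-3) and three more factors C, hence the exponent 14.
      M₀ : Carrier
      M₀ = h * A * D ^ 14

      A-form : A ≈ M₀ * (⟨ + 2 ⟩ * C ^ 14)
      A-form = sym (begin
        h * A * D ^ 14 * (⟨ + 2 ⟩ * C ^ 14)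
          ≈⟨ solve 4 (λ h a d c → h :* a :* d :^ 14 :* (con (+ 2) :* c :^ 14) := con (+ 2) :* h :* a :* (d :* c) :^ 14) refl h A D C ⟩
        ⟨ + 2 ⟩ * h * A * (D * C) ^ 14   ≈⟨ *-cong (*-congʳ half) (^-one D*C 14) ⟩
        1# * A * 1#                      ≈⟨ trans (*-identityʳ _) (*-identityˡ A) ⟩
        A                                ∎)

      one-form : 1# ≈ M₀ * (⟨ + 2 ⟩ * C ^ 11 * ((⟨ + 2 ⟩ - C) * ((⟨ + 2 ⟩ - C) * (⟨ + 2 ⟩ - C))))
      one-form = sym (begin
        h * A * D ^ 14 * (⟨ + 2 ⟩ * C ^ 11 * ((⟨ + 2 ⟩ - C) * ((⟨ + 2 ⟩ - C) * (⟨ + 2 ⟩ - C))))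
          ≈⟨ solve 5 (λ h a d c s → h :* a :* d :^ 14 :* (con (+ 2) :* c :^ 11 :* (s :* (s :* s)))
                := con (+ 2) :* h :* (a :* ((d :* s) :* ((d :* s) :* (d :* s)))) :* (d :* c) :^ 11) refl h A D C (⟨ + 2 ⟩ - C) ⟩
        ⟨ + 2 ⟩ * h * (A * ((D * (⟨ + 2 ⟩ - C)) * ((D * (⟨ + 2 ⟩ - C)) * (D * (⟨ + 2 ⟩ - C))))) * (D * C) ^ 11
          ≈⟨ *-cong (*-cong half (trans (*-congˡ (*-cong D*s (*-cong D*s D*s))) (cube-inverse root))) (^-one D*C 11) ⟩
        1# * 1# * 1#                     ≈⟨ trans (*-identityʳ _) (*-identityˡ 1#) ⟩
        1#                               ∎)

      open UnsignedSystem R φ using (one; z₀f)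

      M₀≈ : 1# ≈ Clearing.W³ R (C * C) M₀ * eval one C ⟨ + 0 ⟩
      M₀≈ = trans one-form (solve 2 (λ m c → let s = con (+ 2) :- c; w = c :* c in
        m :* (con (+ 2) :* c :^ 11 :* (s :* (s :* s))) := m :* w :* w :* w :* one c (con (+ 0))) refl M₀ C)

      closed-form : evalPoly (neg 2 ∷ + 3 ∷ + 1 ∷ []) x * 1# + evalPoly (+ 2 ∷ neg 15 ∷ + 29 ∷ neg 4 ∷ + 2 ∷ []) x * A
        ≈ ⟨ + 2 ⟩ * (Clearing.W³ R (C * C) M₀ * eval z₀f C ⟨ + 0 ⟩)
      closed-form = begin
        -- The quadratic needs two spare factors W = C^2, so C^11 is split as W^2 C^7; the quartic
        -- needs four, so C^14 is split as W^4 C^6.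
        _ ≈⟨ +-cong (homogenize-correct (neg 2) (+ 3 ∷ + 1 ∷ []) (trans one-form
                      (solve 2 (λ m c → let s = con (+ 2) :- c; w = c :* c in
                        m :* (con (+ 2) :* c :^ 11 :* (s :* (s :* s))) := m :* w :* w :* (con (+ 2) :* c :^ 7 :* (s :* (s :* s)))) refl M₀ C)))
                    (homogenize-correct (+ 2) (neg 15 ∷ + 29 ∷ neg 4 ∷ + 2 ∷ []) (trans A-form
                      (solve 2 (λ m c → let w = c :* c in m :* (con (+ 2) :* c :^ 14) := m :* w :* w :* w :* w :* (con (+ 2) :* c :^ 6)) refl M₀ C))) ⟩
        _ ≈⟨ solve 2 (λ m c → let s = con (+ 2) :- c; w = c :* c in
               m :* homog w (c :- con (+ 1)) (neg 2 ∷ + 3 ∷ + 1 ∷ []) (con (+ 2) :* c :^ 7 :* (s :* (s :* s)))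
               :+ m :* homog w (c :- con (+ 1)) (+ 2 ∷ neg 15 ∷ + 29 ∷ neg 4 ∷ + 2 ∷ []) (con (+ 2) :* c :^ 6)
               := con (+ 2) :* (m :* w :* w :* w :* z₀f c (con (+ 0)))) refl M₀ C ⟩
        _ ∎
        where open Homogenization (C * C) (C - ⟨ + 1 ⟩) x quadratic-C

    module SignedRoot {x B b : Carrier}
      (root : B * B * (1-4 (x * x) * (1-4 (x * x) * 1-4 (x * x))) ≈ 1#)
      (eT : ⟨ + 1 ⟩ - ⟨ + 2 ⟩ * (x * b) ≈ B * (1-4 (x * x) * 1-4 (x * x)))
      (cancel : ∀ f → ⟨ + 4 ⟩ * (x * f) ≈ 0# → f ≈ 0#) where

      private
        U = 1-4 (x * x)
        T = B * (U * U)
        W = ⟨ + 1 ⟩ + b * b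
        ν = ⟨ + 1 ⟩ - x * b

      quadratic-b : x * W ≈ b
      quadratic-b = sym (x-y≈0⇒x≈y _ _ (cancel _ (begin
        ⟨ + 4 ⟩ * (x * (b - x * W))
          ≈⟨ solve 2 (λ x b → con (+ 4) :* (x :* (b :- x :* (con (+ 1) :+ b :* b))) :=
                (con (+ 1) :- con (+ 4) :* (x :* x)) :- (con (+ 1) :- con (+ 2) :* (x :* b)) :* (con (+ 1) :- con (+ 2) :* (x :* b))) refl x b ⟩
        U - (⟨ + 1 ⟩ - ⟨ + 2 ⟩ * (x * b)) * (⟨ + 1 ⟩ - ⟨ + 2 ⟩ * (x * b))
          ≈⟨ +-congˡ (-‿cong (trans (*-cong eT eT) (square-root root))) ⟩
        U - U ≈⟨ -‿inverseʳ U ⟩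
        0# ∎)))

      ν*W : ν * W ≈ 1#
      ν*W = begin
        ν * W                     ≈⟨ solve 2 (λ x b → let w = con (+ 1) :+ b :* b in (con (+ 1) :- x :* b) :* w := w :- b :* (x :* w)) refl x b ⟩
        W - b * (x * W)           ≈⟨ +-congˡ (-‿cong (*-congˡ quadratic-b)) ⟩
        W - b * b                 ≈⟨ solve 1 (λ b → con (+ 1) :+ b :* b :- b :* b := con (+ 1)) refl b ⟩
        ⟨ + 1 ⟩                   ≈⟨ 1-homo ⟩
        1#                        ∎

      ν*v : ν * (⟨ + 1 ⟩ - b * b) ≈ T
      ν*v = begin
        ν * (⟨ + 1 ⟩ - b * b)     ≈⟨ solve 2 (λ x b → let w = con (+ 1) :+ b :* b in (con (+ 1) :- x :* b) :* (con (+ 1) :- b :* b)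
                                        := con (+ 1) :- con (+ 2) :* (x :* b) :- b :* (b :- x :* w)) refl x b ⟩
        ⟨ + 1 ⟩ - ⟨ + 2 ⟩ * (x * b) - b * (b - x * W) ≈⟨ +-cong eT (-‿cong (*-congˡ (x≈y⇒x-y≈0 (sym quadratic-b)))) ⟩
        T - b * 0#                ≈⟨ trans (+-congˡ (-‿cong (trans (zeroʳ b) (sym 0-homo)))) (solve 1 (λ t → t :- con (+ 0) := t) refl T) ⟩
        T                         ∎

      -- The inverse of (1 + b^2)^7 (1 - b^2)^3, where the 7 is 4 plus the three factors of `W³`.
      -- Since 1 - b^2 = (1 + b^2) T, the cube contributes B = T^(-3) and three more factors ν.
      M₀ : Carrier
      M₀ = B * ν ^ 10

      B-form : B ≈ M₀ * W ^ 10
      B-form = sym (begin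
        B * ν ^ 10 * W ^ 10       ≈⟨ solve 3 (λ b n w → b :* n :^ 10 :* w :^ 10 := b :* (n :* w) :^ 10) refl B ν W ⟩
        B * (ν * W) ^ 10          ≈⟨ *-congˡ (^-one ν*W 10) ⟩
        B * 1#                    ≈⟨ *-identityʳ B ⟩
        B                         ∎)

      one-form : 1# ≈ M₀ * (W ^ 7 * ((⟨ + 1 ⟩ - b * b) * ((⟨ + 1 ⟩ - b * b) * (⟨ + 1 ⟩ - b * b))))
      one-form = sym (begin
        B * ν ^ 10 * (W ^ 7 * ((⟨ + 1 ⟩ - b * b) * ((⟨ + 1 ⟩ - b * b) * (⟨ + 1 ⟩ - b * b))))
          ≈⟨ solve 4 (λ b n w v → b :* n :^ 10 :* (w :^ 7 :* (v :* (v :* v))) := b :* ((n :* v) :* ((n :* v) :* (n :* v))) :* (n :* w) :^ 7)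
               refl B ν W (⟨ + 1 ⟩ - b * b) ⟩
        B * ((ν * (⟨ + 1 ⟩ - b * b)) * ((ν * (⟨ + 1 ⟩ - b * b)) * (ν * (⟨ + 1 ⟩ - b * b)))) * (ν * W) ^ 7
          ≈⟨ *-cong (trans (*-congˡ (*-cong ν*v (*-cong ν*v ν*v))) (cube-inverse root)) (^-one ν*W 7) ⟩
        1# * 1#                   ≈⟨ *-identityˡ 1# ⟩
        1#                        ∎)

      open SignedSystem R φ using (one; zφ; w; v)

      M₀≈ : 1# ≈ Clearing.W³ R W M₀ * eval one b ⟨ + 0 ⟩
      M₀≈ = trans one-form (solve 2 (λ m b →
        m :* (w b :^ 7 :* (v b :* (v b :* v b))) := m :* w b :* w b :* w b :* one b (con (+ 0))) refl M₀ b)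

      closed-form : evalPoly (+ 2 ∷ neg 5 ∷ neg 9 ∷ + 6 ∷ + 2 ∷ []) x * 1#
          - evalPoly (+ 2 ∷ neg 5 ∷ neg 21 ∷ + 36 ∷ + 64 ∷ neg 76 ∷ neg 48 ∷ + 16 ∷ []) x * B
        ≈ ⟨ + 2 ⟩ * (Clearing.W³ R W M₀ * eval zφ b ⟨ + 0 ⟩)
      closed-form = begin
        _ ≈⟨ +-cong (homogenize-correct (+ 2) (neg 5 ∷ neg 9 ∷ + 6 ∷ + 2 ∷ []) (trans one-form
                      (solve 2 (λ m b → m :* (w b :^ 7 :* (v b :* (v b :* v b)))
                        := m :* w b :* w b :* w b :* w b :* (w b :^ 3 :* (v b :* (v b :* v b)))) refl M₀ b)))
                    (-‿cong (homogenize-correct (+ 2) (neg 5 ∷ neg 21 ∷ + 36 ∷ + 64 ∷ neg 76 ∷ neg 48 ∷ + 16 ∷ []) (trans B-form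
                      (solve 2 (λ m b → m :* w b :^ 10 := m :* w b :* w b :* w b :* w b :* w b :* w b :* w b :* w b :^ 3) refl M₀ b)))) ⟩
        _ ≈⟨ solve 2 (λ m b →
               m :* homog (w b) b (+ 2 ∷ neg 5 ∷ neg 9 ∷ + 6 ∷ + 2 ∷ []) (w b :^ 3 :* (v b :* (v b :* v b)))
               :- m :* homog (w b) b (+ 2 ∷ neg 5 ∷ neg 21 ∷ + 36 ∷ + 64 ∷ neg 76 ∷ neg 48 ∷ + 16 ∷ []) (w b :^ 3)
               := con (+ 2) :* (m :* w b :* w b :* w b :* zφ b (con (+ 0)))) refl M₀ b ⟩
        _ ∎
        where open Homogenization W b x quadratic-b

open RingAlgebra
open import Data.Rational using (ℚ; _+_; _*_; _-_; -_; _/_; 0ℚ; 1ℚ; 1/_)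
import Data.Rational.Properties as ℚₚ
open import Data.Rational.Literals using (fromℤ)
open import Data.Rational.Solver using (module +-*-Solver)
open +-*-Solver using (solve; con; _:+_; _:*_; _:-_; :-_; _:=_)
open ≡ using (refl; sym; trans; cong; cong₂; subst; module ≡-Reasoning)

-- Formal power series

infix  4 _≐_
infixl 25 _·_
infix  21 ⊖_

_≐_ : Series → Series → Set
f ≐ g = ∀ n → f n ≡ g n

tail : Series → Series
tail f n = f (suc n)

-- Recursion on the tail of the first factor, rather than an indexed sum, gives the ring laws by
-- induction on the coefficient; `⊛-·` identifies it with the product of the statement.
_·_ : Series → Series → Series
(f · g) zero    = f 0 * g 0
(f · g) (suc n) = f 0 * g (suc n) + (tail f · g) n

const : ℚ → Series
const q zero    = q
const q (suc n) = 0ℚ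

⊖_ : Series → Series
(⊖ f) n = - f n

x : Series
x zero          = 0ℚ
x (suc zero)    = 1ℚ
x (suc (suc n)) = 0ℚ

const-0 : ∀ n → const 0ℚ n ≡ 0ℚ
const-0 zero    = refl
const-0 (suc n) = refl

tail-const : ∀ q → tail (const q) ≐ const 0ℚ
tail-const q n = sym (const-0 n)

tail-x : tail x ≐ const 1ℚ
tail-x zero    = refl
tail-x (suc n) = refl

·-cong : ∀ {f f′ g g′} → f ≐ f′ → g ≐ g′ → f · g ≐ f′ · g′
·-cong p q zero    = cong₂ _*_ (p 0) (q 0)
·-cong p q (suc n) = cong₂ _+_ (cong₂ _*_ (p 0) (q (suc n))) (·-cong (p ∘ suc) q n)

·-distribʳ : ∀ h f g → (f ⊕ g) · h ≐ (f · h) ⊕ (g · h)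
·-distribʳ h f g zero    = ℚₚ.*-distribʳ-+ (h 0) (f 0) (g 0)
·-distribʳ h f g (suc n) = begin
  (f 0 + g 0) * h (suc n) + ((tail f ⊕ tail g) · h) n
    ≡⟨ cong (λ a → (f 0 + g 0) * h (suc n) + a) (·-distribʳ h (tail f) (tail g) n) ⟩
  (f 0 + g 0) * h (suc n) + ((tail f · h) n + (tail g · h) n)
    ≡⟨ solve 5 (λ a b c d e → (a :+ b) :* c :+ (d :+ e) := (a :* c :+ d) :+ (b :* c :+ e)) refl
         (f 0) (g 0) (h (suc n)) ((tail f · h) n) ((tail g · h) n) ⟩
  (f 0 * h (suc n) + (tail f · h) n) + (g 0 * h (suc n) + (tail g · h) n) ∎
  where open ≡-Reasoning

scale-· : ∀ q f g → scale q f · g ≐ scale q (f · g)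
scale-· q f g zero    = ℚₚ.*-assoc q (f 0) (g 0)
scale-· q f g (suc n) = begin
  q * f 0 * g (suc n) + (scale q (tail f) · g) n
    ≡⟨ cong (λ a → q * f 0 * g (suc n) + a) (scale-· q (tail f) g n) ⟩
  q * f 0 * g (suc n) + q * (tail f · g) n
    ≡⟨ solve 4 (λ q a b c → q :* a :* b :+ q :* c := q :* (a :* b :+ c)) refl q (f 0) (g (suc n)) ((tail f · g) n) ⟩
  q * (f 0 * g (suc n) + (tail f · g) n) ∎
  where open ≡-Reasoning

·-assoc : ∀ f g h → (f · g) · h ≐ f · (g · h)
·-assoc f g h zero    = ℚₚ.*-assoc (f 0) (g 0) (h 0)
·-assoc f g h (suc n) = begin
  f 0 * g 0 * h (suc n) + ((scale (f 0) (tail g) ⊕ (tail f · g)) · h) n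
    ≡⟨ cong (λ a → f 0 * g 0 * h (suc n) + a) (·-distribʳ h (scale (f 0) (tail g)) (tail f · g) n) ⟩
  f 0 * g 0 * h (suc n) + ((scale (f 0) (tail g) · h) n + ((tail f · g) · h) n)
    ≡⟨ cong₂ (λ a b → f 0 * g 0 * h (suc n) + (a + b)) (scale-· (f 0) (tail g) h n) (·-assoc (tail f) g h n) ⟩
  f 0 * g 0 * h (suc n) + (f 0 * (tail g · h) n + (tail f · (g · h)) n)
    ≡⟨ solve 5 (λ a b c d e → a :* b :* c :+ (a :* d :+ e) := a :* (b :* c :+ d) :+ e) refl
         (f 0) (g 0) (h (suc n)) ((tail g · h) n) ((tail f · (g · h)) n) ⟩
  f 0 * (g 0 * h (suc n) + (tail g · h) n) + (tail f · (g · h)) n ∎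
  where open ≡-Reasoning

-- The mirror image of the defining recursion, peeling the second factor; commutativity compares the
-- two.
·-tailʳ : ∀ f g n → (f · g) (suc n) ≡ f (suc n) * g 0 + (f · tail g) n
·-tailʳ f g zero    = ℚₚ.+-comm (f 0 * g 1) (f 1 * g 0)
·-tailʳ f g (suc n) = begin
  f 0 * g (suc (suc n)) + (tail f · g) (suc n)
    ≡⟨ cong (λ a → f 0 * g (suc (suc n)) + a) (·-tailʳ (tail f) g n) ⟩
  f 0 * g (suc (suc n)) + (f (suc (suc n)) * g 0 + (tail f · tail g) n)
    ≡⟨ solve 3 (λ a b c → a :+ (b :+ c) := b :+ (a :+ c)) refl
         (f 0 * g (suc (suc n))) (f (suc (suc n)) * g 0) ((tail f · tail g) n) ⟩
  f (suc (suc n)) * g 0 + (f 0 * g (suc (suc n)) + (tail f · tail g) n) ∎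
  where open ≡-Reasoning

·-comm : ∀ f g → f · g ≐ g · f
·-comm f g zero    = ℚₚ.*-comm (f 0) (g 0)
·-comm f g (suc n) = trans
  (cong₂ _+_ (ℚₚ.*-comm (f 0) (g (suc n))) (·-comm (tail f) g n))
  (sym (·-tailʳ g f n))

const0-· : ∀ f → const 0ℚ · f ≐ const 0ℚ
const0-· f zero    = ℚₚ.*-zeroˡ (f 0)
const0-· f (suc n) = trans (cong (_+ (tail (const 0ℚ) · f) n) (ℚₚ.*-zeroˡ (f (suc n))))
  (trans (ℚₚ.+-identityˡ _) (trans (·-cong {g = f} (tail-const 0ℚ) (λ _ → refl) n)
    (trans (const0-· f n) (const-0 n))))

const-· : ∀ q f → const q · f ≐ scale q f
const-· q f zero    = refl
const-· q f (suc n) = begin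
  q * f (suc n) + (tail (const q) · f) n
    ≡⟨ cong (λ a → q * f (suc n) + a) (·-cong {g = f} (tail-const q) (λ _ → refl) n) ⟩
  q * f (suc n) + (const 0ℚ · f) n
    ≡⟨ cong (λ a → q * f (suc n) + a) (trans (const0-· f n) (const-0 n)) ⟩
  q * f (suc n) + 0ℚ
    ≡⟨ ℚₚ.+-identityʳ _ ⟩
  q * f (suc n) ∎
  where
  open ≡-Reasoning

x-·-suc : ∀ f n → (x · f) (suc n) ≡ f n
x-·-suc f n = begin
  0ℚ * f (suc n) + (tail x · f) n
    ≡⟨ cong₂ _+_ (ℚₚ.*-zeroˡ (f (suc n))) (·-cong {g = f} tail-x (λ _ → refl) n) ⟩
  0ℚ + (const 1ℚ · f) n
    ≡⟨ trans (ℚₚ.+-identityˡ _) (const-· 1ℚ f n) ⟩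
  1ℚ * f n
    ≡⟨ ℚₚ.*-identityˡ (f n) ⟩
  f n ∎
  where open ≡-Reasoning

x-·-zero : ∀ f → (x · f) 0 ≡ 0ℚ
x-·-zero f = ℚₚ.*-zeroˡ (f 0)

series-ring : CommutativeRing 0ℓ 0ℓ
series-ring = record
  { Carrier = Series ; _≈_ = _≐_ ; _+_ = _⊕_ ; _*_ = _·_ ; -_ = ⊖_
  ; 0# = const 0ℚ ; 1# = const 1ℚ
  ; isCommutativeRing = record
    { isRing = record
      { +-isAbelianGroup = record
        { isGroup = record
          { isMonoid = record
            { isSemigroup = record
              { isMagma = record
                { isEquivalence = record
                  { refl = λ _ → refl ; sym = λ p n → sym (p n) ; trans = λ p q n → trans (p n) (q n) }
                ; ∙-cong = λ p q n → cong₂ _+_ (p n) (q n) }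
              ; assoc = λ f g h n → ℚₚ.+-assoc (f n) (g n) (h n) }
            ; identity = (λ f n → trans (cong (_+ f n) (const-0 n)) (ℚₚ.+-identityˡ (f n)))
                       , (λ f n → trans (cong (λ a → f n + a) (const-0 n)) (ℚₚ.+-identityʳ (f n))) }
          ; inverse = (λ f n → trans (ℚₚ.+-inverseˡ (f n)) (sym (const-0 n)))
                    , (λ f n → trans (ℚₚ.+-inverseʳ (f n)) (sym (const-0 n)))
          ; ⁻¹-cong = λ p n → cong -_ (p n) }
        ; comm = λ f g n → ℚₚ.+-comm (f n) (g n) }
      ; *-cong = ·-cong
      ; *-assoc = ·-assoc
      ; *-identity = one-· , (λ f n → trans (·-comm f (const 1ℚ) n) (one-· f n))
      ; distrib = (λ h f g n → trans (·-comm h (f ⊕ g) n) (trans (·-distribʳ h f g n)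
                    (cong₂ _+_ (·-comm f h n) (·-comm g h n)))) , ·-distribʳ }
    ; *-comm = ·-comm } }
  where
  one-· : ∀ f → const 1ℚ · f ≐ f
  one-· f n = trans (const-· 1ℚ f n) (ℚₚ.*-identityˡ (f n))

-- `fromℤ` computes, whereas `_/ 1` normalizes a fraction. A sum of rationals unfolds to a quotient,
-- here by 1, and `↥p/↧p≡p` translates between the two.
fromℤ-+ : ∀ a b → fromℤ (a ℤ.+ b) ≡ fromℤ a + fromℤ b
fromℤ-+ a b = begin
  fromℤ (a ℤ.+ b)                          ≡⟨ sym (ℚₚ.↥p/↧p≡p (fromℤ (a ℤ.+ b))) ⟩
  (a ℤ.+ b) / 1                            ≡⟨ cong (_/ 1) (sym (cong₂ ℤ._+_ (ℤₚ.*-identityʳ a) (ℤₚ.*-identityʳ b))) ⟩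
  (a ℤ.* ℤ.+ 1 ℤ.+ b ℤ.* ℤ.+ 1) / 1            ∎
  where open ≡-Reasoning

fromℤ-* : ∀ a b → fromℤ (a ℤ.* b) ≡ fromℤ a * fromℤ b
fromℤ-* a b = sym (ℚₚ.↥p/↧p≡p (fromℤ (a ℤ.* b)))

fromℤ-neg : ∀ a → fromℤ (ℤ.- a) ≡ - fromℤ a
fromℤ-neg (ℤ.+ zero)  = refl
fromℤ-neg (ℤ.+ suc n) = refl
fromℤ-neg ℤ.-[1+ n ]  = refl

integer : ℤ-raw -Raw-AlmostCommutative⟶ fromCommutativeRing series-ring
integer = record
  { ⟦_⟧    = λ a → const (fromℤ a)
  ; +-homo = λ { a b zero → fromℤ-+ a b ; a b (suc n) → refl }
  ; *-homo = λ { a b n → trans (const-* a b n) (sym (const-· (fromℤ a) (const (fromℤ b)) n)) }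
  ; -‿homo = λ { a zero → fromℤ-neg a ; a (suc n) → refl }
  ; 0-homo = λ _ → refl
  ; 1-homo = λ _ → refl }
  where
  const-* : ∀ a b n → const (fromℤ (a ℤ.* b)) n ≡ fromℤ a * const (fromℤ b) n
  const-* a b zero    = fromℤ-* a b
  const-* a b (suc n) = sym (ℚₚ.*-zeroʳ (fromℤ a))

-- Building permutations by prepending letters

Σ< : ℕ → (ℕ → ℚ) → ℚ
Σ< zero    F = 0ℚ
Σ< (suc n) F = F 0 + Σ< n (F ∘ suc)

Σ<-cong : ∀ n {F G} → (∀ c → c < n → F c ≡ G c) → Σ< n F ≡ Σ< n G
Σ<-cong zero    p = refl
Σ<-cong (suc n) p = cong₂ _+_ (p 0 (s≤s z≤n)) (Σ<-cong n λ c c<n → p (suc c) (s≤s c<n))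

Σ<-+ : ∀ n F G → Σ< n (λ c → F c + G c) ≡ Σ< n F + Σ< n G
Σ<-+ zero    F G = refl
Σ<-+ (suc n) F G = trans (cong ((F 0 + G 0) +_) (Σ<-+ n (F ∘ suc) (G ∘ suc)))
  (solve 4 (λ a b c d → a :+ b :+ (c :+ d) := (a :+ c) :+ (b :+ d)) refl (F 0) (G 0) (Σ< n (F ∘ suc)) (Σ< n (G ∘ suc)))

Σ<-* : ∀ n q F → Σ< n (λ c → q * F c) ≡ q * Σ< n F
Σ<-* zero    q F = sym (ℚₚ.*-zeroʳ q)
Σ<-* (suc n) q F = trans (cong ((q * F 0) +_) (Σ<-* n q (F ∘ suc))) (sym (ℚₚ.*-distribˡ-+ q (F 0) _))

-- The order embedding of ℕ into ℕ ∖ {c}.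
shift : ℕ → ℕ → ℕ
shift zero    b       = suc b
shift (suc c) zero    = zero
shift (suc c) (suc b) = suc (shift c b)

Σ<-skip : ∀ n c F → c ≤ n → F c ≡ 0ℚ → Σ< (suc n) F ≡ Σ< n (F ∘ shift c)
Σ<-skip n       zero    F _         F0 = trans (cong (_+ Σ< n (F ∘ suc)) F0) (ℚₚ.+-identityˡ _)
Σ<-skip (suc n) (suc c) F (s≤s c≤n) Fc = cong (F 0 +_) (Σ<-skip n c (F ∘ suc) c≤n Fc)

-- From filtered vectors to sums over permutations

ind : Bool → ℚ
ind true  = 1ℚ
ind false = 0ℚ

ind-∧ : ∀ a b → ind (a ∧ b) ≡ ind a * ind b
ind-∧ true  b = sym (ℚₚ.*-identityˡ (ind b))
ind-∧ false b = sym (ℚₚ.*-zeroˡ (ind b))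

sumL : ∀ {A : Set} → (A → ℚ) → List A → ℚ
sumL f []       = 0ℚ
sumL f (a ∷ as) = f a + sumL f as

sumL-++ : ∀ {A : Set} (f : A → ℚ) as bs → sumL f (as ++ bs) ≡ sumL f as + sumL f bs
sumL-++ f []       bs = sym (ℚₚ.+-identityˡ _)
sumL-++ f (a ∷ as) bs = trans (cong (f a +_) (sumL-++ f as bs)) (sym (ℚₚ.+-assoc (f a) _ _))

sumL-map : ∀ {A B : Set} (f : B → ℚ) (g : A → B) as → sumL f (map g as) ≡ sumL (f ∘ g) as
sumL-map f g []       = refl
sumL-map f g (a ∷ as) = cong (f (g a) +_) (sumL-map f g as)

sumL-concatMap : ∀ {A B : Set} (f : B → ℚ) (g : A → List B) as →
  sumL f (concatMap g as) ≡ sumL (λ a → sumL f (g a)) as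
sumL-concatMap f g []       = refl
sumL-concatMap f g (a ∷ as) = trans (sumL-++ f (g a) (concatMap g as)) (cong (sumL f (g a) +_) (sumL-concatMap f g as))

sumL-tabulate : ∀ n {A : Set} (f : A → ℚ) (F : ℕ → ℚ) (g : Fin n → A) → (∀ i → f (g i) ≡ F (toℕ i)) →
  sumL f (tabulate g) ≡ Σ< n F
sumL-tabulate zero    f F g p = refl
sumL-tabulate (suc n) f F g p = cong₂ _+_ (p fzero) (sumL-tabulate n f (F ∘ suc) (g ∘ fsuc) (p ∘ fsuc))

count-sumL : ∀ {A : Set} (p : A → Bool) as → (ℤ.+ length (filterᵇ p as)) / 1 ≡ sumL (ind ∘ p) as
count-sumL p as = trans (ℚₚ.↥p/↧p≡p (fromℤ (ℤ.+ length (filterᵇ p as)))) (lem as)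
  where
  lem : ∀ as → fromℤ (ℤ.+ length (filterᵇ p as)) ≡ sumL (ind ∘ p) as
  lem []       = refl
  lem (a ∷ as) with p a
  ... | true  = trans (fromℤ-+ (ℤ.+ 1) (ℤ.+ length (filterᵇ p as))) (cong (1ℚ +_) (lem as))
  ... | false = trans (lem as) (sym (ℚₚ.+-identityˡ _))

words : ℕ → ℕ → (List ℕ → ℚ) → ℚ
words n zero    f = f []
words n (suc k) f = Σ< n (λ i → words n k (f ∘ (i ∷_)))

words-cong : ∀ n k {f g} → (∀ w → f w ≡ g w) → words n k f ≡ words n k g
words-cong n zero    p = p []
words-cong n (suc k) p = Σ<-cong n λ i _ → words-cong n k (p ∘ (i ∷_))

words-0 : ∀ n k → words n k (λ _ → 0ℚ) ≡ 0ℚ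
words-0 n zero    = refl
-- 0 is presented as 0 * 0, so that `Σ<-*` can extract a factor 0.
words-0 n (suc k) = trans (Σ<-cong n {G = λ _ → 0ℚ * 0ℚ} λ _ _ → words-0 n k) (trans (Σ<-* n 0ℚ (λ _ → 0ℚ)) (ℚₚ.*-zeroˡ (Σ< n (λ _ → 0ℚ))))

sumL-vecs : ∀ n k (f : List ℕ → ℚ) → sumL (f ∘ toℕs) (vecs n k) ≡ words n k f
sumL-vecs n zero    f = ℚₚ.+-identityʳ (f [])
sumL-vecs n (suc k) f = trans (sumL-concatMap (f ∘ toℕs) (λ i → map (i ∷_) (vecs n k)) (allFin n))
  (sumL-tabulate n _ (λ i → words n k (f ∘ (i ∷_))) id λ i →
    trans (sumL-map (f ∘ toℕs) (i ∷_) (vecs n k)) (sumL-vecs n k (f ∘ (toℕ i ∷_))))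

≡ᵇ-refl : ∀ c → (c ≡ᵇ c) ≡ true
≡ᵇ-refl zero    = refl
≡ᵇ-refl (suc c) = ≡ᵇ-refl c

shift-≢ : ∀ c b → (c ≡ᵇ shift c b) ≡ false
shift-≢ zero    b       = refl
shift-≢ (suc c) zero    = refl
shift-≢ (suc c) (suc b) = shift-≢ c b

shift-≡ᵇ : ∀ c a b → (shift c a ≡ᵇ shift c b) ≡ (a ≡ᵇ b)
shift-≡ᵇ zero    a       b       = refl
shift-≡ᵇ (suc c) zero    zero    = refl
shift-≡ᵇ (suc c) zero    (suc b) = refl
shift-≡ᵇ (suc c) (suc a) zero    = refl
shift-≡ᵇ (suc c) (suc a) (suc b) = shift-≡ᵇ c a b

shift-<ᵇ : ∀ c a b → (shift c a <ᵇ shift c b) ≡ (a <ᵇ b)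
shift-<ᵇ zero    a       b       = refl
shift-<ᵇ (suc c) zero    zero    = refl
shift-<ᵇ (suc c) zero    (suc b) = refl
shift-<ᵇ (suc c) (suc a) zero    = refl
shift-<ᵇ (suc c) (suc a) (suc b) = shift-<ᵇ c a b

<ᵇ-shift : ∀ c b → (c <ᵇ shift c b) ≡ not (b <ᵇ c)
<ᵇ-shift zero    b       = refl
<ᵇ-shift (suc c) zero    = refl
<ᵇ-shift (suc c) (suc b) = <ᵇ-shift c b

shift-<ᵇ-low : ∀ {d c} b → d ≤ c → (shift c b <ᵇ d) ≡ (b <ᵇ d)
shift-<ᵇ-low b       z≤n       = refl
shift-<ᵇ-low zero    (s≤s d≤c) = refl
shift-<ᵇ-low (suc b) (s≤s d≤c) = shift-<ᵇ-low b d≤c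

shift-<ᵇ-high : ∀ {c d} b → c ≤ d → (shift c b <ᵇ suc d) ≡ (b <ᵇ d)
shift-<ᵇ-high b       z≤n       = refl
shift-<ᵇ-high zero    (s≤s c≤d) = refl
shift-<ᵇ-high (suc b) (s≤s c≤d) = shift-<ᵇ-high b c≤d

elemᵇ-shift : ∀ c a l → elemᵇ (shift c a) (map (shift c) l) ≡ elemᵇ a l
elemᵇ-shift c a []      = refl
elemᵇ-shift c a (b ∷ l) = cong₂ _∨_ (shift-≡ᵇ c a b) (elemᵇ-shift c a l)

distinct-shift : ∀ c l → distinct (map (shift c) l) ≡ distinct l
distinct-shift c []      = refl
distinct-shift c (a ∷ l) = cong₂ (λ p q → not p ∧ q) (elemᵇ-shift c a l) (distinct-shift c l)

-- At each position the letter i contributes 0; `Σ<-skip` drops it and renumbers the other letters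
-- by `shift i`.
words-avoiding : ∀ n k i g → i ≤ n →
  words (suc n) k (λ w → ind (not (elemᵇ i w)) * g w) ≡ words n k (g ∘ map (shift i))
words-avoiding n zero    i g i≤n = ℚₚ.*-identityˡ (g [])
words-avoiding n (suc k) i g i≤n = trans (Σ<-skip n i (λ j → words (suc n) k (λ w → ind (not (elemᵇ i (j ∷ w))) * g (j ∷ w))) i≤n vanish) (Σ<-cong n λ j _ → trans
  (words-cong (suc n) k λ w → cong (λ b → ind (not (b ∨ elemᵇ i w)) * g (shift i j ∷ w)) (shift-≢ i j))
  (words-avoiding n k i (g ∘ (shift i j ∷_)) i≤n))
  where
  vanish : words (suc n) k (λ w → ind (not ((i ≡ᵇ i) ∨ elemᵇ i w)) * g (i ∷ w)) ≡ 0ℚ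
  vanish = trans (words-cong (suc n) k λ w →
    trans (cong (λ b → ind (not (b ∨ elemᵇ i w)) * g (i ∷ w)) (≡ᵇ-refl i)) (ℚₚ.*-zeroˡ (g (i ∷ w))))
    (words-0 (suc n) k)

-- The sum of f over the permutations of length n: those of length n + 1 arise
-- uniquely by prepending a letter c and making room for it.
perms : ℕ → (List ℕ → ℚ) → ℚ
perms zero    f = f []
perms (suc n) f = Σ< (suc n) (λ c → perms n (λ σ → f (c ∷ map (shift c) σ)))

perms-words : ∀ n f → words n n (λ w → ind (distinct w) * f w) ≡ perms n f
perms-words zero    f = ℚₚ.*-identityˡ (f [])
perms-words (suc n) f = Σ<-cong (suc n) λ { i (s≤s i≤n) → begin
  words (suc n) n (λ w → ind (not (elemᵇ i w) ∧ distinct w) * f (i ∷ w))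
    ≡⟨ words-cong (suc n) n (λ w → trans (cong (_* f (i ∷ w)) (ind-∧ (not (elemᵇ i w)) (distinct w))) (ℚₚ.*-assoc (ind (not (elemᵇ i w))) (ind (distinct w)) (f (i ∷ w)))) ⟩
  words (suc n) n (λ w → ind (not (elemᵇ i w)) * (ind (distinct w) * f (i ∷ w)))
    ≡⟨ words-avoiding n n i _ i≤n ⟩
  words n n (λ w → ind (distinct (map (shift i) w)) * f (i ∷ map (shift i) w))
    ≡⟨ words-cong n n (λ w → cong (λ b → ind b * f (i ∷ map (shift i) w)) (distinct-shift i w)) ⟩
  words n n (λ w → ind (distinct w) * f (i ∷ map (shift i) w))
    ≡⟨ perms-words n _ ⟩
  perms n (λ w → f (i ∷ map (shift i) w)) ∎ }
  where open ≡-Reasoning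

-- Inversions and occurrences after prepending a letter

countᵇ-map : ∀ (p : ℕ → Bool) (f : ℕ → ℕ) l → countᵇ p (map f l) ≡ countᵇ (p ∘ f) l
countᵇ-map p f []      = refl
countᵇ-map p f (a ∷ l) with p (f a)
... | true  = cong suc (countᵇ-map p f l)
... | false = countᵇ-map p f l

countᵇ-cong : ∀ {p q : ℕ → Bool} → (∀ a → p a ≡ q a) → ∀ l → countᵇ p l ≡ countᵇ q l
countᵇ-cong         e []      = refl
countᵇ-cong {p} {q} e (a ∷ l) with p a | q a | e a
... | true  | true  | _ = cong suc (countᵇ-cong e l)
... | false | false | _ = countᵇ-cong e l

countᵇ-split : ∀ (p q : ℕ → Bool) l → countᵇ q l ≡ countᵇ (λ a → p a ∧ q a) l ℕ.+ countᵇ (λ a → not (p a) ∧ q a) l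
countᵇ-split p q []      = refl
countᵇ-split p q (a ∷ l) with p a | q a
... | true  | true  = cong suc (countᵇ-split p q l)
... | false | true  = trans (cong suc (countᵇ-split p q l)) (sym (ℕₚ.+-suc _ _))
... | true  | false = countᵇ-split p q l
... | false | false = countᵇ-split p q l

countᵇ-none : ∀ l → countᵇ (λ _ → false) l ≡ 0
countᵇ-none []      = refl
countᵇ-none (a ∷ l) = countᵇ-none l

-- This is h(d). As b < a in an inversion, only the smaller entry b has to be tested against d.
invFrom : ℕ → List ℕ → ℕ
invFrom d []      = 0
invFrom d (a ∷ l) = countᵇ (λ b → not (b <ᵇ d) ∧ (b <ᵇ a)) l ℕ.+ invFrom d l

-- The trace of being a permutation of 0, ..., m - 1 on which the counts rest: initial segments,
-- hence intervals, contain the right number of entries.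
Balanced : ℕ → List ℕ → Set
Balanced m σ = ∀ d → d ≤ m → countᵇ (_<ᵇ d) σ ≡ d

<ᵇ-false : ∀ {c d} → d ≤ c → (c <ᵇ d) ≡ false
<ᵇ-false z≤n       = refl
<ᵇ-false (s≤s d≤c) = <ᵇ-false d≤c

<ᵇ-true : ∀ {c d} → c ≤ d → (c <ᵇ suc d) ≡ true
<ᵇ-true z≤n       = refl
<ᵇ-true (s≤s c≤d) = <ᵇ-true c≤d

<ᵇ-∧-low : ∀ {d c} b → d ≤ c → ((b <ᵇ d) ∧ (b <ᵇ c)) ≡ (b <ᵇ d)
<ᵇ-∧-low b       z≤n       = refl
<ᵇ-∧-low zero    (s≤s d≤c) = refl
<ᵇ-∧-low (suc b) (s≤s d≤c) = <ᵇ-∧-low b d≤c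

<ᵇ-∧-high : ∀ {d c} b → c ≤ d → (not (b <ᵇ d) ∧ (b <ᵇ c)) ≡ false
<ᵇ-∧-high b       z≤n       = ∧-zeroʳ _
<ᵇ-∧-high zero    (s≤s c≤d) = refl
<ᵇ-∧-high (suc b) (s≤s c≤d) = <ᵇ-∧-high b c≤d

invFrom-shift-low : ∀ {d c} σ → d ≤ c → invFrom d (map (shift c) σ) ≡ invFrom d σ
invFrom-shift-low         []      d≤c = refl
invFrom-shift-low {d} {c} (a ∷ σ) d≤c = cong₂ ℕ._+_
  (trans (countᵇ-map _ (shift c) σ) (countᵇ-cong (λ b → cong₂ (λ p q → not p ∧ q) (shift-<ᵇ-low b d≤c) (shift-<ᵇ c b a)) σ))
  (invFrom-shift-low σ d≤c)

invFrom-shift-high : ∀ {d c} σ → c ≤ d → invFrom (suc d) (map (shift c) σ) ≡ invFrom d σ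
invFrom-shift-high         []      c≤d = refl
invFrom-shift-high {d} {c} (a ∷ σ) c≤d = cong₂ ℕ._+_
  (trans (countᵇ-map _ (shift c) σ) (countᵇ-cong (λ b → cong₂ (λ p q → not p ∧ q) (shift-<ᵇ-high b c≤d) (shift-<ᵇ c b a)) σ))
  (invFrom-shift-high σ c≤d)

balanced-∷ : ∀ {m c} σ → c ≤ m → Balanced m σ → Balanced (suc m) (c ∷ map (shift c) σ)
balanced-∷ {m} {c} σ c≤m bal d d≤m with ℕₚ.≤-<-connex d c
balanced-∷ {m} {c} σ c≤m bal d d≤m | inj₁ d≤c rewrite <ᵇ-false d≤c =
  trans (countᵇ-map _ (shift c) σ) (trans (countᵇ-cong (λ b → shift-<ᵇ-low b d≤c) σ) (bal d (ℕₚ.≤-trans d≤c c≤m)))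
balanced-∷ {m} {c} σ c≤m bal (suc d) (s≤s d≤m) | inj₂ (s≤s c≤d) rewrite <ᵇ-true c≤d =
  cong suc (trans (countᵇ-map _ (shift c) σ) (trans (countᵇ-cong (λ b → shift-<ᵇ-high b c≤d) σ) (bal d d≤m)))

-- The function h after prepending c. For d ≤ c the new letter forms inversions with the c - d
-- entries from d to c - 1; for d > c only the relabelling shows, giving h(d - 1). Structural
-- recursion lets shapes of h be followed by induction.
step : ℕ → (ℕ → ℕ) → ℕ → ℕ
step zero    h zero    = h 0
step zero    h (suc d) = h d
step (suc c) h zero    = h 0 ℕ.+ suc c
step (suc c) h (suc d) = step c (h ∘ suc) d

step-low : ∀ {d c} h → d ≤ c → step c h d ≡ h d ℕ.+ (c ∸ d)
step-low {c = zero}  h z≤n       = sym (ℕₚ.+-identityʳ (h 0))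
step-low {c = suc c} h z≤n       = refl
step-low             h (s≤s d≤c) = step-low (h ∘ suc) d≤c

step-high : ∀ {d c} h → c ≤ d → step c h (suc d) ≡ h d
step-high             h z≤n       = refl
step-high             h (s≤s c≤d) = step-high (h ∘ suc) c≤d

step-cong : ∀ c {h h′} → (∀ d → h d ≡ h′ d) → ∀ d → step c h d ≡ step c h′ d
step-cong zero    e zero    = e 0
step-cong zero    e (suc d) = e d
step-cong (suc c) e zero    = cong (ℕ._+ suc c) (e 0)
step-cong (suc c) e (suc d) = step-cong c (e ∘ suc) d

invFrom-∷ : ∀ {m c} σ → c ≤ m → Balanced m σ → ∀ d →
  invFrom d (c ∷ map (shift c) σ) ≡ step c (λ d → invFrom d σ) d
invFrom-∷ {m} {c} σ c≤m bal d with ℕₚ.≤-<-connex d c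
invFrom-∷ {m} {c} σ c≤m bal d | inj₁ d≤c = begin
  countᵇ (λ b → not (b <ᵇ d) ∧ (b <ᵇ c)) (map (shift c) σ) ℕ.+ invFrom d (map (shift c) σ)
    ≡⟨ cong₂ ℕ._+_ (trans (countᵇ-map _ (shift c) σ) (countᵇ-cong (λ b → cong₂ (λ p q → not p ∧ q) (shift-<ᵇ-low b d≤c) (shift-<ᵇ-low b (ℕₚ.≤-refl {c}))) σ)) (invFrom-shift-low σ d≤c) ⟩
  between ℕ.+ invFrom d σ
    ≡⟨ cong (ℕ._+ invFrom d σ) (sym (trans (cong (_∸ d) split) (ℕₚ.m+n∸m≡n d between))) ⟩
  (c ∸ d) ℕ.+ invFrom d σ
    ≡⟨ ℕₚ.+-comm (c ∸ d) (invFrom d σ) ⟩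
  invFrom d σ ℕ.+ (c ∸ d)
    ≡⟨ sym (step-low (λ d → invFrom d σ) d≤c) ⟩
  step c (λ d → invFrom d σ) d ∎
  where
  open ≡-Reasoning
  between = countᵇ (λ b → not (b <ᵇ d) ∧ (b <ᵇ c)) σ
  -- Balance at c and at d leaves c - d entries from d to c - 1.
  split : c ≡ d ℕ.+ between
  split = begin
    c                                                     ≡⟨ sym (bal c c≤m) ⟩
    countᵇ (_<ᵇ c) σ                                      ≡⟨ countᵇ-split (_<ᵇ d) (_<ᵇ c) σ ⟩
    countᵇ (λ b → (b <ᵇ d) ∧ (b <ᵇ c)) σ ℕ.+ between      ≡⟨ cong (ℕ._+ between) (countᵇ-cong (λ b → <ᵇ-∧-low b d≤c) σ) ⟩
    countᵇ (_<ᵇ d) σ ℕ.+ between                          ≡⟨ cong (ℕ._+ between) (bal d (ℕₚ.≤-trans d≤c c≤m)) ⟩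
    d ℕ.+ between                                         ∎
invFrom-∷ {m} {c} σ c≤m bal (suc d) | inj₂ (s≤s c≤d) = begin
  countᵇ (λ b → not (b <ᵇ suc d) ∧ (b <ᵇ c)) (map (shift c) σ) ℕ.+ invFrom (suc d) (map (shift c) σ)
    ≡⟨ cong₂ ℕ._+_ (trans (countᵇ-cong (λ b → <ᵇ-∧-high b (ℕₚ.m≤n⇒m≤1+n c≤d)) (map (shift c) σ)) (countᵇ-none (map (shift c) σ))) (invFrom-shift-high σ c≤d) ⟩
  invFrom d σ
    ≡⟨ sym (step-high (λ d → invFrom d σ) c≤d) ⟩
  step c (λ d → invFrom d σ) (suc d) ∎
  where open ≡-Reasoning

-- The new letter plays the 1 of 132. A shifted entry exceeds c exactly when the old one is at least
-- c, so the other two letters form an inversion among the entries ≥ c.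
pairs132-shift : ∀ c σ → pairs132 c (map (shift c) σ) ≡ invFrom c σ
pairs132-shift c []      = refl
pairs132-shift c (b ∷ σ) = cong₂ ℕ._+_
  (trans (countᵇ-map _ (shift c) σ) (countᵇ-cong (λ a → cong₂ _∧_ (<ᵇ-shift c a) (shift-<ᵇ c a b)) σ))
  (pairs132-shift c σ)

pairs132-mono : ∀ c a σ → pairs132 (shift c a) (map (shift c) σ) ≡ pairs132 a σ
pairs132-mono c a []      = refl
pairs132-mono c a (b ∷ σ) = cong₂ ℕ._+_
  (trans (countᵇ-map _ (shift c) σ) (countᵇ-cong (λ e → cong₂ _∧_ (shift-<ᵇ c a e) (shift-<ᵇ c e b)) σ))
  (pairs132-mono c a σ)

occ132-shift : ∀ c σ → occ132 (map (shift c) σ) ≡ occ132 σ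
occ132-shift c []      = refl
occ132-shift c (a ∷ σ) = cong₂ ℕ._+_ (pairs132-mono c a σ) (occ132-shift c σ)

inv-shift : ∀ c σ → inv (map (shift c) σ) ≡ inv σ
inv-shift c []      = refl
inv-shift c (a ∷ σ) = cong₂ ℕ._+_
  (trans (countᵇ-map _ (shift c) σ) (countᵇ-cong (λ b → shift-<ᵇ c b a) σ)) (inv-shift c σ)

inv-∷ : ∀ {m c} σ → c ≤ m → Balanced m σ → inv (c ∷ map (shift c) σ) ≡ c ℕ.+ inv σ
inv-∷ {m} {c} σ c≤m bal = cong₂ ℕ._+_
  (trans (countᵇ-map _ (shift c) σ) (trans (countᵇ-cong (λ b → shift-<ᵇ-low b (ℕₚ.≤-refl {c})) σ) (bal c c≤m)))
  (inv-shift c σ)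

perms-cong : ∀ n {f g} → (∀ σ → Balanced n σ → f σ ≡ g σ) → perms n f ≡ perms n g
perms-cong zero    p = p [] λ { zero _ → refl }
perms-cong (suc n) p = Σ<-cong (suc n) λ { c (s≤s c≤n) → perms-cong n λ σ bal → p (c ∷ map (shift c) σ) (balanced-∷ σ c≤n bal) }

perms-+ : ∀ n f g → perms n (λ σ → f σ + g σ) ≡ perms n f + perms n g
perms-+ zero    f g = refl
perms-+ (suc n) f g = trans (Σ<-cong (suc n) λ c _ → perms-+ n (prepend c f) (prepend c g))
  (Σ<-+ (suc n) (λ c → perms n (prepend c f)) (λ c → perms n (prepend c g)))
  where
  prepend : ℕ → (List ℕ → ℚ) → List ℕ → ℚ
  prepend c f σ = f (c ∷ map (shift c) σ)

perms-0 : ∀ n → perms n (λ _ → 0ℚ) ≡ 0ℚ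
perms-0 zero    = refl
perms-0 (suc n) = trans (Σ<-cong (suc n) {G = λ _ → 0ℚ * 0ℚ} λ _ _ → perms-0 n) (trans (Σ<-* (suc n) 0ℚ (λ _ → 0ℚ)) (ℚₚ.*-zeroˡ (Σ< (suc n) (λ _ → 0ℚ))))

perms-Σ< : ∀ n k (F : ℕ → List ℕ → ℚ) → perms n (λ σ → Σ< k (λ c → F c σ)) ≡ Σ< k (λ c → perms n (F c))
perms-Σ< n zero    F = perms-0 n
perms-Σ< n (suc k) F = trans (perms-+ n (F 0) _) (cong (perms n (F 0) +_) (perms-Σ< n k (F ∘ suc)))

^ℚ-+ : ∀ y a b → y ^ℚ (a ℕ.+ b) ≡ y ^ℚ b * y ^ℚ a
^ℚ-+ y zero    b = sym (ℚₚ.*-identityʳ _)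
^ℚ-+ y (suc a) b = trans (cong (_* y) (^ℚ-+ y a b)) (ℚₚ.*-assoc (y ^ℚ b) (y ^ℚ a) y)

-- The weighted number of ways to prepend n letters to a permutation of length m
-- having o occurrences of 132 and h d inversions among its entries ≥ d, so that
-- two occurrences result.
extensions : ℚ → ℕ → ℕ → (ℕ → ℕ) → ℕ → ℚ
extensions y zero    m h o = ind (o ≡ᵇ 2)
extensions y (suc n) m h o = Σ< (suc m) (λ c → y ^ℚ c * extensions y n (suc m) (step c h) (h c ℕ.+ o))

extensions-cong : ∀ y n m {h h′} o → (∀ d → h d ≡ h′ d) → extensions y n m h o ≡ extensions y n m h′ o
extensions-cong y zero    m o e = refl
extensions-cong y (suc n) m o e = Σ<-cong (suc m) λ c _ → cong ((y ^ℚ c) *_)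
  (trans (extensions-cong y n (suc m) _ (step-cong c e)) (cong (λ a → extensions y n (suc m) _ (a ℕ.+ o)) (e c)))

weight : ℚ → List ℕ → ℚ
weight y σ = y ^ℚ inv σ * ind (occ132 σ ≡ᵇ 2)

-- Each step of the induction turns the first prepended letter into a letter of σ. Extensions see σ
-- only through its length, h and its occurrences, all of which change as `extensions` prescribes.
perms-extensions : ∀ y n m →
  perms m (λ σ → y ^ℚ inv σ * extensions y n m (λ d → invFrom d σ) (occ132 σ)) ≡ perms (n ℕ.+ m) (weight y)
perms-extensions y zero    m = refl
perms-extensions y (suc n) m = begin
  perms m (λ σ → y ^ℚ inv σ * Σ< (suc m) (λ c → y ^ℚ c * ext c σ))
    ≡⟨ perms-cong m (λ σ _ → sym (Σ<-* (suc m) (y ^ℚ inv σ) (λ c → y ^ℚ c * ext c σ))) ⟩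
  perms m (λ σ → Σ< (suc m) (λ c → y ^ℚ inv σ * (y ^ℚ c * ext c σ)))
    ≡⟨ perms-Σ< m (suc m) (λ c σ → y ^ℚ inv σ * (y ^ℚ c * ext c σ)) ⟩
  Σ< (suc m) (λ c → perms m (λ σ → y ^ℚ inv σ * (y ^ℚ c * ext c σ)))
    ≡⟨ Σ<-cong (suc m) (λ { c (s≤s c≤m) → perms-cong m λ σ bal → prepend c σ c≤m bal }) ⟩
  perms (suc m) (λ σ → y ^ℚ inv σ * extensions y n (suc m) (λ d → invFrom d σ) (occ132 σ))
    ≡⟨ perms-extensions y n (suc m) ⟩
  perms (n ℕ.+ suc m) (weight y)
    ≡⟨ cong (λ k → perms k (weight y)) (ℕₚ.+-suc n m) ⟩
  perms (suc n ℕ.+ m) (weight y) ∎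
  where
  open ≡-Reasoning
  ext : ℕ → List ℕ → ℚ
  ext c σ = extensions y n (suc m) (step c (λ d → invFrom d σ)) (invFrom c σ ℕ.+ occ132 σ)
  prepend : ∀ c σ → c ≤ m → Balanced m σ → y ^ℚ inv σ * (y ^ℚ c * ext c σ) ≡
    y ^ℚ inv (c ∷ map (shift c) σ) * extensions y n (suc m) (λ d → invFrom d (c ∷ map (shift c) σ)) (occ132 (c ∷ map (shift c) σ))
  prepend c σ c≤m bal = begin
    y ^ℚ inv σ * (y ^ℚ c * ext c σ)
      ≡⟨ sym (ℚₚ.*-assoc (y ^ℚ inv σ) (y ^ℚ c) (ext c σ)) ⟩
    y ^ℚ inv σ * y ^ℚ c * ext c σ
      ≡⟨ cong₂ _*_ (sym (trans (cong (y ^ℚ_) (inv-∷ σ c≤m bal)) (^ℚ-+ y c (inv σ))))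
          (trans (extensions-cong y n (suc m) (invFrom c σ ℕ.+ occ132 σ) (λ d → sym (invFrom-∷ σ c≤m bal d)))
            (cong (extensions y n (suc m) _) (sym (cong₂ ℕ._+_ (pairs132-shift c σ) (occ132-shift c σ))))) ⟩
    y ^ℚ inv (c ∷ map (shift c) σ) * extensions y n (suc m) (λ d → invFrom d (c ∷ map (shift c) σ)) (occ132 (c ∷ map (shift c) σ)) ∎

perms-weight : ∀ y n → perms n (weight y) ≡ extensions y n 0 (λ _ → 0) 0
perms-weight y n = begin
  perms n (weight y)           ≡⟨ cong (λ k → perms k (weight y)) (sym (ℕₚ.+-identityʳ n)) ⟩
  perms (n ℕ.+ 0) (weight y)   ≡⟨ sym (perms-extensions y n 0) ⟩
  1ℚ * extensions y n 0 (λ _ → 0) 0 ≡⟨ ℚₚ.*-identityˡ _ ⟩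
  extensions y n 0 (λ _ → 0) 0 ∎
  where open ≡-Reasoning

count-perms : ∀ n (p : ℕ → Bool) →
  (ℤ.+ length (filterᵇ (λ v → let l = toℕs v in distinct l ∧ p (inv l) ∧ (occ132 l ≡ᵇ 2)) (vecs n n))) / 1
    ≡ perms n (λ σ → ind (p (inv σ)) * ind (occ132 σ ≡ᵇ 2))
count-perms n p = begin
  _ ≡⟨ count-sumL _ (vecs n n) ⟩
  _ ≡⟨ sumL-vecs n n (λ l → ind (distinct l ∧ p (inv l) ∧ (occ132 l ≡ᵇ 2))) ⟩
  words n n (λ l → ind (distinct l ∧ p (inv l) ∧ (occ132 l ≡ᵇ 2)))
    ≡⟨ words-cong n n (λ l → trans (ind-∧ (distinct l) _) (cong (ind (distinct l) *_) (ind-∧ (p (inv l)) _))) ⟩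
  words n n (λ l → ind (distinct l) * (ind (p (inv l)) * ind (occ132 l ≡ᵇ 2)))
    ≡⟨ perms-words n _ ⟩
  perms n (λ σ → ind (p (inv σ)) * ind (occ132 σ ≡ᵇ 2)) ∎
  where open ≡-Reasoning

1^ : ∀ k → 1ℚ ^ℚ k ≡ ind (isEven k) + ind (not (isEven k))
1^ zero    = refl
1^ (suc k) = trans (cong (_* 1ℚ) (1^ k)) (lem (isEven k))
  where
  lem : ∀ b → (ind b + ind (not b)) * 1ℚ ≡ ind (not b) + ind (not (not b))
  lem true  = refl
  lem false = refl

-1^ : ∀ k → (- 1ℚ) ^ℚ k ≡ ind (isEven k) + - 1ℚ * ind (not (isEven k))
-1^ zero    = refl
-1^ (suc k) = trans (cong (_* - 1ℚ) (-1^ k)) (lem (isEven k))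
  where
  lem : ∀ b → (ind b + - 1ℚ * ind (not b)) * - 1ℚ ≡ ind (not b) + - 1ℚ * ind (not (not b))
  lem true  = refl
  lem false = refl

perms-* : ∀ n q f → perms n (λ σ → q * f σ) ≡ q * perms n f
perms-* zero    q f = refl
perms-* (suc n) q f = trans (Σ<-cong (suc n) λ c _ → perms-* n q (λ σ → f (c ∷ map (shift c) σ)))
  (Σ<-* (suc n) q (λ c → perms n (λ σ → f (c ∷ map (shift c) σ))))

-- The hypothesis says that y^k only depends on the parity of k; it is applied to y = 1 and y = -1.
parity-sum : ∀ n y → (∀ k → y ^ℚ k ≡ ind (isEven k) + y * ind (not (isEven k))) →
  E2 n + y * O2 n ≡ extensions y n 0 (λ _ → 0) 0
parity-sum n y yk = begin
  E2 n + y * O2 n ≡⟨ cong₂ (λ a b → a + y * b) (count-perms n isEven) (count-perms n (not ∘ isEven)) ⟩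
  perms n ev + y * perms n od ≡⟨ cong (perms n ev +_) (sym (perms-* n y od)) ⟩
  perms n ev + perms n (λ σ → y * od σ) ≡⟨ sym (perms-+ n ev (λ σ → y * od σ)) ⟩
  perms n (λ σ → ev σ + y * od σ) ≡⟨ perms-cong n (λ σ _ → trans
     (solve 4 (λ a b y k → a :* k :+ y :* (b :* k) := (a :+ y :* b) :* k) refl (ind (isEven (inv σ))) (ind (not (isEven (inv σ)))) y (ind (occ132 σ ≡ᵇ 2)))
     (cong (_* ind (occ132 σ ≡ᵇ 2)) (sym (yk (inv σ))))) ⟩
  perms n (weight y) ≡⟨ perms-weight y n ⟩
  extensions y n 0 (λ _ → 0) 0 ∎
  where
  open ≡-Reasoning
  ev od : List ℕ → ℚ
  ev σ = ind (isEven (inv σ)) * ind (occ132 σ ≡ᵇ 2)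
  od σ = ind (not (isEven (inv σ))) * ind (occ132 σ ≡ᵇ 2)

-- Extensions solve the recurrences

module SR = CommutativeRing series-ring

-- Shapes of h and their change under a new letter

Tail : List ℕ → (ℕ → ℕ) → Set
Tail []       h = ∀ d → h d ≡ 0
Tail (a ∷ ks) h = h 0 ≡ a × Tail ks (h ∘ suc)

-- Below s only a lower bound k is kept: once k exceeds the number of occurrences still allowed,
-- letters there contribute nothing. The list holds the few exact values that precede the zeros.
Profile : ℕ → ℕ → List ℕ → (ℕ → ℕ) → Set
Profile k zero    ks h = Tail ks h
Profile k (suc s) ks h = k ≤ h 0 × Profile k s ks (h ∘ suc)

profile-≤ : ∀ {k k′} s {ks h} → k′ ≤ k → Profile k s ks h → Profile k′ s ks h
profile-≤ zero    k′≤k p       = p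
profile-≤ (suc s) k′≤k (q , p) = ℕₚ.≤-trans k′≤k q , profile-≤ s k′≤k p

profile-absorb : ∀ {k a} s {ks h} → k ≤ a → Profile k s (a ∷ ks) h → Profile k (suc s) ks h
profile-absorb zero    k≤a (refl , p) = k≤a , p
profile-absorb (suc s) k≤a (q , p)    = q , profile-absorb s k≤a p

profile-grow : ∀ t {h} → Profile 0 t [] h → Profile 0 (suc t) [] h
profile-grow zero    p       = z≤n , p ∘ suc
profile-grow (suc t) (_ , p) = z≤n , profile-grow t p

profile-zero : ∀ {k} t {h} → Profile k t [] h → h t ≡ 0
profile-zero zero    p       = p 0
profile-zero (suc t) (_ , p) = profile-zero t p

profile-head : ∀ {k a} s {ks h} → Profile k s (a ∷ ks) h → h s ≡ a
profile-head zero    (q , _) = q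
profile-head (suc s) (_ , p) = profile-head s p

profile-below : ∀ {k ks} s {h} → Profile k s ks h → ∀ c → c < s → k ≤ h c
profile-below (suc s) (q , _) zero    _         = q
profile-below (suc s) (_ , p) (suc c) (s≤s c<s) = profile-below s p c c<s

step-0 : ∀ {h} → Tail [] h → Tail [] (step 0 h)
step-0 p zero    = p 0
step-0 p (suc d) = p d

private
  ≤-add : ∀ {k} a b → k ≤ a → suc b ℕ.+ k ≤ a ℕ.+ suc b
  ≤-add {k} a b k≤a = subst (_≤ a ℕ.+ suc b) (ℕₚ.+-comm k (suc b)) (ℕₚ.+-monoˡ-≤ (suc b) k≤a)

-- Letter t + j writes j, ..., 1 at the positions t, ..., t + j - 1 and adds at least j + 1 to each
-- value below t. Here j = 0; the next two lemmas are j = 1 and j = 2.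
step-t : ∀ {k} t {h} → Profile k t [] h → Profile (suc k) t [] (step t h)
step-t     zero    p       = step-0 p
step-t {k} (suc t) {h} (q , p) = ℕₚ.≤-trans (s≤s (ℕₚ.m≤n+m k t)) (≤-add (h 0) t q) , step-t t p

step-1+t : ∀ {k} t {h} → Profile k t [] h → Profile (2 ℕ.+ k) t (1 ∷ []) (step (suc t) h)
step-1+t     zero    p       = cong (ℕ._+ 1) (p 0) , step-0 (p ∘ suc)
step-1+t {k} (suc t) {h} (q , p) = ℕₚ.≤-trans (s≤s (s≤s (ℕₚ.m≤n+m k t))) (≤-add (h 0) (suc t) q) , step-1+t t p

step-2+t : ∀ {k} t {h} → Profile k t [] h → Profile (3 ℕ.+ k) t (2 ∷ 1 ∷ []) (step (2 ℕ.+ t) h)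
step-2+t     zero    p       = cong (ℕ._+ 2) (p 0) , cong (ℕ._+ 1) (p 1) , step-0 (p ∘ suc ∘ suc)
step-2+t {k} (suc t) {h} (q , p) = ℕₚ.≤-trans (s≤s (s≤s (s≤s (ℕₚ.m≤n+m k t)))) (≤-add (h 0) (suc (suc t)) q) , step-2+t t p

step-1 : ∀ {k} s {h} → Profile k s (1 ∷ []) h → Profile (2 ℕ.+ k) s (2 ∷ []) (step (suc s) h)
step-1     zero    (q , p) = cong (ℕ._+ 1) q , step-0 p
step-1 {k} (suc s) {h} (q , p) = ℕₚ.≤-trans (s≤s (s≤s (ℕₚ.m≤n+m k s))) (≤-add (h 0) (suc s) q) , step-1 s p

-- A letter s inside the initial segment repeats the value h s, which moves the zeros up by one.
-- This is the effect of a letter that creates occurrences.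
step-below : ∀ {k} s j {h} → Profile k (suc (s ℕ.+ j)) [] h → Profile k (suc (suc (s ℕ.+ j))) [] (step s h)
step-below zero    j     p@(q , _) = q , p
step-below (suc s) j {h} (q , p)   = ℕₚ.≤-trans q (ℕₚ.m≤m+n (h 0) (suc s)) , step-below s j p

step-below′ : ∀ {k} s {h} → Profile k (suc s) [] h → Profile k (2 ℕ.+ s) [] (step s h)
step-below′ {k} s {h} p = subst (λ j → Profile k (2 ℕ.+ j) [] (step s h)) (ℕₚ.+-identityʳ s)
  (step-below s 0 (subst (λ j → Profile k (suc j) [] h) (sym (ℕₚ.+-identityʳ s)) p))

step-below″ : ∀ {k} s {h} → Profile k (2 ℕ.+ s) [] h → Profile k (3 ℕ.+ s) [] (step s h)
step-below″ {k} s {h} p = subst (λ j → Profile k (2 ℕ.+ j) [] (step s h)) (ℕₚ.+-comm s 1)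
  (step-below s 1 (subst (λ j → Profile k (suc j) [] h) (sym (ℕₚ.+-comm s 1)) p))

step-dup : ∀ {k} s {h} → Profile k s (1 ∷ []) h → Profile k s (1 ∷ 1 ∷ []) (step s h)
step-dup zero        (q , p) = q , q , p
step-dup (suc s) {h} (q , p) = ℕₚ.≤-trans q (ℕₚ.m≤m+n (h 0) (suc s)) , step-dup s p

-- Restriction of the sums to the affordable letters

range : (ℕ → ℚ) → ℕ → ℕ → ℚ
range F t zero    = 0ℚ
range F t (suc k) = F t + range F (suc t) k

range-suc : ∀ F t k → range (F ∘ suc) t k ≡ range F (suc t) k
range-suc F t zero    = refl
range-suc F t (suc k) = cong (F (suc t) +_) (range-suc F (suc t) k)

Σ<-range : ∀ s k F → (∀ c → c < s → F c ≡ 0ℚ) → Σ< (s ℕ.+ k) F ≡ range F s k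
Σ<-range zero    zero    F p = refl
Σ<-range zero    (suc k) F p = cong (F 0 +_) (trans (Σ<-range zero k (F ∘ suc) λ _ ()) (range-suc F 0 k))
Σ<-range (suc s) k F p = trans (cong₂ _+_ (p 0 (s≤s z≤n)) (Σ<-range s k (F ∘ suc) λ c c<s → p (suc c) (s≤s c<s)))
  (trans (ℚₚ.+-identityˡ _) (range-suc F s k))

z : ℚ → ℕ → Series
z y t = const (y ^ℚ t) · x

z-suc : ∀ y t f n → (z y t · f) (suc n) ≡ y ^ℚ t * f n
z-suc y t f n = trans (·-assoc (const (y ^ℚ t)) x f (suc n))
  (trans (const-· (y ^ℚ t) (x · f) (suc n)) (cong (y ^ℚ t *_) (x-·-suc f n)))

z-zero : ∀ y t f → (z y t · f) 0 ≡ 0ℚ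
z-zero y t f = trans (·-assoc (const (y ^ℚ t)) x f 0)
  (trans (const-· (y ^ℚ t) (x · f) 0) (trans (cong (y ^ℚ t *_) (x-·-zero f)) (ℚₚ.*-zeroʳ (y ^ℚ t))))

-- Every solution of the recurrences counts extensions

module Solution (y : ℚ) (V U Z : ℕ → ℕ → Series) 
  (system : Families.System series-ring (z y) V U Z) where
  open Families series-ring (z y) V U Z
  open System system

  ext = extensions y

  extensions-none : ∀ n m h o → 3 ≤ o → ext n m h o ≡ 0ℚ
  extensions-none zero    m h .(suc (suc (suc _))) (s≤s (s≤s (s≤s z≤n))) = refl
  extensions-none (suc n) m h o 3≤o = trans
    (Σ<-cong (suc m) {G = λ _ → 0ℚ * 0ℚ} λ c _ → trans
      (cong (y ^ℚ c *_) (extensions-none n (suc m) (step c h) (h c ℕ.+ o) (ℕₚ.≤-trans 3≤o (ℕₚ.m≤n+m o (h c)))))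
      (ℚₚ.*-zeroʳ (y ^ℚ c)))
    (trans (Σ<-* (suc m) 0ℚ (λ _ → 0ℚ)) (ℚₚ.*-zeroˡ (Σ< (suc m) (λ _ → 0ℚ))))

  term : ℕ → ℕ → (ℕ → ℕ) → ℕ → ℕ → ℚ
  term n m h o c = y ^ℚ c * ext n m (step c h) (h c ℕ.+ o)

  term-≡ : ∀ n m h o c {a} {f : Series} → h c ≡ a → ext n m (step c h) (a ℕ.+ o) ≡ f n →
    term n m h o c ≡ (z y c · f) (suc n)
  term-≡ n m h o c {f = f} refl e = trans (cong (y ^ℚ c *_) e) (sym (z-suc y c f n))

  extensions-range : ∀ n m s H {k ks} h o → 3 ≤ k ℕ.+ o → Profile k s ks h → suc m ≡ s ℕ.+ H →
    ext (suc n) m h o ≡ range (term n (suc m) h o) s H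
  extensions-range n m s H {k} h o 3≤k+o p e = trans (cong (λ j → Σ< j (term n (suc m) h o)) e)
    (Σ<-range s H _ λ c c<s → trans
      (cong (y ^ℚ c *_) (extensions-none n (suc m) (step c h) _ (ℕₚ.≤-trans 3≤k+o (ℕₚ.+-monoˡ-≤ o (profile-below s p c c<s)))))
      (ℚₚ.*-zeroʳ (y ^ℚ c)))

  +0 : ∀ {a b} → a ≡ b → a + 0ℚ ≡ b
  +0 e = trans (ℚₚ.+-identityʳ _) e

  module _ (n : ℕ) (V-ext : ∀ t H m h → m ≡ t ℕ.+ H → Profile 1 t [] h → ext n m h 2 ≡ V t H n) where

    -- The induction passes from t to t + 1, so the zero at t enters the initial segment and only
    -- the bound 0 survives. It suffices, because a letter adds at least 1 to every value below it.
    V-range : ∀ t H m h → suc m ≡ t ℕ.+ suc H → Profile 0 t [] h →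
      range (term n (suc m) h 2) t (suc H) ≡ V t H (suc n)
    V-term : ∀ t H m h → suc m ≡ t ℕ.+ suc H → Profile 0 t [] h →
      term n (suc m) h 2 t ≡ (z y t · V t (suc H)) (suc n)
    V-term t H m h e p = term-≡ n (suc m) h 2 t {f = V t (suc H)} (profile-zero t p) (V-ext t (suc H) (suc m) _ e (step-t t p))
    V-range t zero    m h e p = trans (+0 (V-term t 0 m h e p))
      (sym (trans (V-0 t (suc n)) (ℚₚ.+-identityˡ _)))
    V-range t (suc H) m h e p = trans
      (cong₂ _+_ (V-term t (suc H) m h e p) (V-range (suc t) H m h (trans e (ℕₚ.+-suc t (suc H))) (profile-grow t p)))
      (trans (ℚₚ.+-comm ((z y t · V t (2 ℕ.+ H)) (suc n)) (V (suc t) H (suc n))) (sym (V-suc t H (suc n))))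

  V-at-0 : ∀ t H → V t H 0 ≡ 1ℚ
  V-at-0 t zero    = trans (V-0 t 0) (cong (1ℚ +_) (z-zero y t (V t 1)))
  V-at-0 t (suc H) = trans (V-suc t H 0) (cong₂ _+_ (V-at-0 (suc t) H) (z-zero y t (V t (2 ℕ.+ H))))

  V-extensions : ∀ n t H m h → m ≡ t ℕ.+ H → Profile 1 t [] h → ext n m h 2 ≡ V t H n
  V-extensions zero    t H m h e p = sym (V-at-0 t H)
  V-extensions (suc n) t H m h e p = trans
    (extensions-range n m t (suc H) h 2 ℕₚ.≤-refl p (trans (cong suc e) (sym (ℕₚ.+-suc t H))))
    (V-range n (V-extensions n) t H m h (trans (cong suc e) (sym (ℕₚ.+-suc t H))) (profile-≤ t z≤n p))

  record U-Extensions (n : ℕ) : Set where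
    field
      at-U₀ : ∀ t H m h → m ≡ t ℕ.+ H → Profile 2 t [] h → ext n m h 1 ≡ U t H n
      at-U₁ : ∀ s H m h → m ≡ suc s ℕ.+ H → Profile 2 s (1 ∷ []) h → ext n m h 1 ≡ U₁ s H n
      at-U₂ : ∀ s H m h → m ≡ 2 ℕ.+ s ℕ.+ H → Profile 2 s (1 ∷ 1 ∷ []) h → ext n m h 1 ≡ U₂ s H n

  module _ (n : ℕ) (IH : U-Extensions n) where
    open U-Extensions IH

    private
      F : ℕ → (ℕ → ℕ) → ℕ → ℚ
      F m h = term n (suc m) h 1

    U-tail-term : ∀ s H m h → suc m ≡ suc s ℕ.+ suc H → Profile 0 s [] h →
      F m h (suc s) ≡ (z y (suc s) · U₁ s (suc H)) (suc n)
    U-tail-term s H m h e p = term-≡ n (suc m) h 1 (suc s) {f = U₁ s (suc H)}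
      (profile-zero (suc s) {h} (profile-grow s p)) (at-U₁ s (suc H) (suc m) _ e (step-1+t s p))

    -- Letter s + 1 leaves the value 1 at s and leads to `U₁ s` instead of U, whence the surplus.
    -- The later letters lead to the same states as when the zeros begin at s + 1.
    U-tail : ∀ s H m h → suc m ≡ suc s ℕ.+ suc H → Profile 0 s [] h →
      range (F m h) (suc s) (suc H) ≡ (U (suc s) H ⊕ z y (suc s) · (z y s · V (2 ℕ.+ s) (suc H))) (suc n)
    U-tail s zero    m h e p = +0 (trans (U-tail-term s 0 m h e p) (lemma₁ (suc s) s))
      where
      lemma₁ : ∀ t s → (z y t · (U t 1 ⊕ z y s · V (1 ℕ.+ t) 1)) (suc n) ≡ (U t 0 ⊕ z y t · (z y s · V (1 ℕ.+ t) 1)) (suc n)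
      lemma₁ t s = trans (SR.distribˡ (z y t) (U t 1) (z y s · V (1 ℕ.+ t) 1) (suc n))
        (cong (_+ (z y t · (z y s · V (1 ℕ.+ t) 1)) (suc n)) (sym (U-0 t (suc n))))
    U-tail s (suc H) m h e p = trans
      (cong₂ _+_ (U-tail-term s (suc H) m h e p)
        (U-tail (suc s) H m h (trans e (cong suc (ℕₚ.+-suc s (suc H)))) (profile-grow s p)))
      (lemma₂ (suc s) s)
      where
      lemma₂ : ∀ t s → (z y t · (U t (2 ℕ.+ H) ⊕ z y s · V (1 ℕ.+ t) (2 ℕ.+ H))) (suc n)
        + (U (suc t) H ⊕ z y (suc t) · (z y t · V (2 ℕ.+ t) (suc H))) (suc n)
        ≡ (U t (suc H) ⊕ z y t · (z y s · V (1 ℕ.+ t) (2 ℕ.+ H))) (suc n)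
      lemma₂ t s = trans
        (cong (_+ (U (suc t) H ⊕ z y (suc t) · (z y t · V (2 ℕ.+ t) (suc H))) (suc n))
          (SR.distribˡ (z y t) (U t (2 ℕ.+ H)) (z y s · V (1 ℕ.+ t) (2 ℕ.+ H)) (suc n)))
        (trans (solve 4 (λ a b c d → (a :+ b) :+ (c :+ d) := ((c :+ a) :+ d) :+ b) refl
           ((z y t · U t (2 ℕ.+ H)) (suc n)) ((z y t · (z y s · V (1 ℕ.+ t) (2 ℕ.+ H))) (suc n))
           (U (suc t) H (suc n)) ((z y (suc t) · (z y t · V (2 ℕ.+ t) (suc H))) (suc n)))
         (cong (_+ (z y t · (z y s · V (1 ℕ.+ t) (2 ℕ.+ H))) (suc n)) (sym (U-suc t H (suc n)))))

    U-range : ∀ t H m h → suc m ≡ t ℕ.+ suc H → Profile 1 t [] h →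
      range (F m h) t (suc H) ≡ U t H (suc n)
    U-range-term : ∀ t H m h → suc m ≡ t ℕ.+ suc H → Profile 1 t [] h →
      F m h t ≡ (z y t · U t (suc H)) (suc n)
    U-range-term t H m h e p = term-≡ n (suc m) h 1 t {f = U t (suc H)}
      (profile-zero t p) (at-U₀ t (suc H) (suc m) _ e (step-t t p))
    U-range t zero    m h e p = +0 (trans (U-range-term t 0 m h e p) (sym (U-0 t (suc n))))
    U-range t (suc H) m h e p = trans
      (cong₂ _+_ (U-range-term t (suc H) m h e p)
        (U-tail t H m h (trans e (ℕₚ.+-suc t (suc H))) (profile-≤ t z≤n p)))
      (trans (solve 3 (λ a b c → a :+ (b :+ c) := (b :+ a) :+ c) refl
        ((z y t · U t (2 ℕ.+ H)) (suc n)) (U (suc t) H (suc n)) ((z y (suc t) · (z y t · V (2 ℕ.+ t) (suc H))) (suc n)))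
        (sym (U-suc t H (suc n))))

  U-at-0 : ∀ t H → U t H 0 ≡ 0ℚ
  U-at-0 t zero    = trans (U-0 t 0) (z-zero y t (U t 1))
  U-at-0 t (suc H) = trans (U-suc t H 0) (cong₂ _+_ (cong₂ _+_ (U-at-0 (suc t) H) (z-zero y t (U t (2 ℕ.+ H))))
    (z-zero y (suc t) (z y t · V (2 ℕ.+ t) (suc H))))

  -- The letter c spends all occurrences that remain, so what follows is counted by V.
  V-term-at : ∀ n c {k} s H m h o {a} → h c ≡ a → a ℕ.+ o ≡ 2 → m ≡ s ℕ.+ H → Profile (suc k) s [] (step c h) →
    term n m h o c ≡ (z y c · V s H) (suc n)
  V-term-at n c s H m h o ha a+o e p = term-≡ n m h o c {f = V s H} ha
    (trans (cong (ext n m (step c h)) a+o) (V-extensions n s H m (step c h) e (profile-≤ s (s≤s z≤n) p)))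

  U-extensions : ∀ n → U-Extensions n
  U-extensions zero = record
    { at-U₀ = λ t H m h _ _ → sym (U-at-0 t H)
    ; at-U₁ = λ s H m h _ _ → sym (cong₂ _+_ (U-at-0 (1 ℕ.+ s) H) (z-zero y s (V (2 ℕ.+ s) H)))
    ; at-U₂ = λ s H m h _ _ → sym (cong₂ _+_ (U-at-0 (2 ℕ.+ s) H) (cong₂ _+_ (z-zero y s (V (3 ℕ.+ s) H)) (z-zero y (suc s) (V (3 ℕ.+ s) H)))) }
  U-extensions (suc n) = record { at-U₀ = u₀ ; at-U₁ = u₁ ; at-U₂ = u₂ }
    where
    IH = U-extensions n
    u₀ : ∀ t H m h → m ≡ t ℕ.+ H → Profile 2 t [] h → ext (suc n) m h 1 ≡ U t H (suc n)
    u₀ t H m h e p = trans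
      (extensions-range n m t (suc H) h 1 ℕₚ.≤-refl p e′) (U-range n IH t H m h e′ (profile-≤ t (s≤s z≤n) p))
      where e′ = trans (cong suc e) (sym (ℕₚ.+-suc t H))
    u₁ : ∀ s H m h → m ≡ suc s ℕ.+ H → Profile 2 s (1 ∷ []) h → ext (suc n) m h 1 ≡ U₁ s H (suc n)
    u₁ s H m h e p = trans (extensions-range n m s (2 ℕ.+ H) h 1 ℕₚ.≤-refl p (trans e′ (sym (ℕₚ.+-suc s (suc H)))))
      (trans (cong₂ _+_ (V-term-at n s (2 ℕ.+ s) H (suc m) h 1 (profile-head s p) refl (cong suc e)
                          (step-below′ s {h} (profile-absorb s ℕₚ.≤-refl (profile-≤ s (s≤s z≤n) p))))
                        (U-range n IH (suc s) H m h e′ (profile-absorb s ℕₚ.≤-refl (profile-≤ s (s≤s z≤n) p))))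
             (ℚₚ.+-comm ((z y s · V (2 ℕ.+ s) H) (suc n)) (U (1 ℕ.+ s) H (suc n))))
      where e′ = trans (cong suc e) (sym (ℕₚ.+-suc (suc s) H))
    u₂ : ∀ s H m h → m ≡ 2 ℕ.+ s ℕ.+ H → Profile 2 s (1 ∷ 1 ∷ []) h → ext (suc n) m h 1 ≡ U₂ s H (suc n)
    u₂ s H m h e p = trans (extensions-range n m s (3 ℕ.+ H) h 1 ℕₚ.≤-refl p
        (trans e′ (trans (cong suc (sym (ℕₚ.+-suc s (suc H)))) (sym (ℕₚ.+-suc s (2 ℕ.+ H))))))
      (trans (cong₂ _+_ (V-term-at n s (3 ℕ.+ s) H (suc m) h 1 (profile-head s p) refl (cong suc e)
                          (step-below″ s {h} p₂))
             (cong₂ _+_ (V-term-at n (suc s) (3 ℕ.+ s) H (suc m) h 1 (profile-head (suc s) {h = h} p₁) refl (cong suc e)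
                          (step-below′ (suc s) {h} p₂))
                        (U-range n IH (2 ℕ.+ s) H m h e′ p₂)))
             (solve 3 (λ a b c → a :+ (b :+ c) := c :+ (a :+ b)) refl ((z y s · V (3 ℕ.+ s) H) (suc n)) ((z y (suc s) · V (3 ℕ.+ s) H) (suc n)) (U (2 ℕ.+ s) H (suc n))))
      where
      e′ = trans (cong suc e) (sym (ℕₚ.+-suc (2 ℕ.+ s) H))
      p₁ : Profile 1 (suc s) (1 ∷ []) h
      p₁ = profile-absorb s ℕₚ.≤-refl (profile-≤ s (s≤s z≤n) p)
      p₂ : Profile 1 (2 ℕ.+ s) [] h
      p₂ = profile-absorb (suc s) {h = h} ℕₚ.≤-refl p₁

  -- The analogues of Z for shapes with 2, with 1, and with 2, 1 just before the zeros; the terms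
  -- added to Z account for letters that use these values.
  β γ δ : ℕ → ℕ → Series
  β s H = Z (1 ℕ.+ s) H ⊕ z y s · V (2 ℕ.+ s) H
  γ s H = Z (1 ℕ.+ s) H ⊕ γ⁺ s H
  δ s H = γ (1 ℕ.+ s) H ⊕ z y s · V (3 ℕ.+ s) H

  record Z-Extensions (n : ℕ) : Set where
    field
      at-α : ∀ t H m h → m ≡ t ℕ.+ H → Profile 3 t [] h → ext n m h 0 ≡ Z t H n
      at-β : ∀ s H m h → m ≡ 1 ℕ.+ s ℕ.+ H → Profile 3 s (2 ∷ []) h → ext n m h 0 ≡ β s H n
      at-γ : ∀ s H m h → m ≡ 1 ℕ.+ s ℕ.+ H → Profile 3 s (1 ∷ []) h → ext n m h 0 ≡ γ s H n
      at-δ : ∀ s H m h → m ≡ 2 ℕ.+ s ℕ.+ H → Profile 3 s (2 ∷ 1 ∷ []) h → ext n m h 0 ≡ δ s H n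

  module _ (n : ℕ) (IH : Z-Extensions n) where
    open Z-Extensions IH

    private
      G : ℕ → (ℕ → ℕ) → ℕ → ℚ
      G m h = term n (suc m) h 0

    δ-term : ∀ s H m h → suc m ≡ 2 ℕ.+ s ℕ.+ suc H → Profile 0 s [] h →
      G m h (2 ℕ.+ s) ≡ (z y (2 ℕ.+ s) · Z (2 ℕ.+ s) (suc H)) (suc n) + (z y (2 ℕ.+ s) · γ⁺ (suc s) (suc H)) (suc n)
        + (z y (2 ℕ.+ s) · (z y s · V (3 ℕ.+ s) (suc H))) (suc n)
    δ-term s H m h e p = trans
      (term-≡ n (suc m) h 0 (2 ℕ.+ s) {f = δ s (suc H)}
        (profile-zero (2 ℕ.+ s) {h} (profile-grow (suc s) {h} (profile-grow s p))) (at-δ s (suc H) (suc m) _ e (step-2+t s p)))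
      (trans (SR.distribˡ (z y (2 ℕ.+ s)) (γ (1 ℕ.+ s) (suc H)) (z y s · V (3 ℕ.+ s) (suc H)) (suc n))
        (cong (_+ (z y (2 ℕ.+ s) · (z y s · V (3 ℕ.+ s) (suc H))) (suc n))
          (SR.distribˡ (z y (2 ℕ.+ s)) (Z (2 ℕ.+ s) (suc H)) (γ⁺ (suc s) (suc H)) (suc n))))

    -- If position s carried at least 3, this would be the sum for zeros beginning at s + 1. Only
    -- letter s + 2 tells the difference, by leaving an affordable 2 at s.
    δ-range : ∀ s H m h → suc m ≡ 2 ℕ.+ s ℕ.+ suc H → Profile 0 s [] h →
      (z y (suc s) · Z (suc s) (2 ℕ.+ H)) (suc n) + range (G m h) (2 ℕ.+ s) (suc H)
        ≡ (Z (suc s) (suc H) ⊕ z y (2 ℕ.+ s) · (z y s · V (3 ℕ.+ s) (suc H))) (suc n)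
    δ-range s zero    m h e p = begin
      zZ + (G m h (2 ℕ.+ s) + 0ℚ)       ≡⟨ cong (λ g → zZ + (g + 0ℚ)) (δ-term s 0 m h e p) ⟩
      zZ + (a + b + c + 0ℚ)             ≡⟨ solve 4 (λ zZ a b c → zZ :+ (a :+ b :+ c :+ con 0ℚ) := (a :+ zZ) :+ b :+ c) refl zZ a b c ⟩
      (a + zZ) + b + c                  ≡⟨ cong (λ a → (a + zZ) + b + c) (sym (Z-0 (2 ℕ.+ s) (suc n))) ⟩
      (Z (2 ℕ.+ s) 0 (suc n) + zZ) + b + c ≡⟨ cong (_+ c) (sym (Z-1 (suc s) (suc n))) ⟩
      Z (suc s) 1 (suc n) + c           ∎
      where
      open ≡-Reasoning
      zZ = (z y (suc s) · Z (suc s) 2) (suc n)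
      a = (z y (2 ℕ.+ s) · Z (2 ℕ.+ s) 1) (suc n)
      b = (z y (2 ℕ.+ s) · γ⁺ (suc s) 1) (suc n)
      c = (z y (2 ℕ.+ s) · (z y s · V (3 ℕ.+ s) 1)) (suc n)
    δ-range s (suc H) m h e p = begin
      zZ + (G m h (2 ℕ.+ s) + R)        ≡⟨ cong (λ g → zZ + (g + R)) (δ-term s (suc H) m h e p) ⟩
      zZ + (a + b + c + R)              ≡⟨ solve 5 (λ zZ a b c R → zZ :+ (a :+ b :+ c :+ R) := (zZ :+ b :+ c) :+ (a :+ R)) refl zZ a b c R ⟩
      (zZ + b + c) + (a + R)            ≡⟨ cong ((zZ + b + c) +_) (δ-range (suc s) H m h (trans e (cong (2 ℕ.+_) (ℕₚ.+-suc s (suc H)))) (profile-grow s p)) ⟩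
      (zZ + b + c) + (Z′ + d)           ≡⟨ solve 5 (λ zZ b c Z′ d → (zZ :+ b :+ c) :+ (Z′ :+ d) := (((Z′ :+ zZ) :+ b) :+ d) :+ c) refl zZ b c Z′ d ⟩
      ((Z′ + zZ) + b + d) + c           ≡⟨ cong (_+ c) (sym (Z-suc (suc s) H (suc n))) ⟩
      Z (suc s) (2 ℕ.+ H) (suc n) + c   ∎
      where
      open ≡-Reasoning
      zZ = (z y (suc s) · Z (suc s) (3 ℕ.+ H)) (suc n)
      a = (z y (2 ℕ.+ s) · Z (2 ℕ.+ s) (2 ℕ.+ H)) (suc n)
      b = (z y (2 ℕ.+ s) · γ⁺ (suc s) (2 ℕ.+ H)) (suc n)
      c = (z y (2 ℕ.+ s) · (z y s · V (3 ℕ.+ s) (2 ℕ.+ H))) (suc n)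
      d = (z y (3 ℕ.+ s) · (z y (suc s) · V (4 ℕ.+ s) (suc H))) (suc n)
      Z′ = Z (2 ℕ.+ s) (suc H) (suc n)
      R = range (G m h) (3 ℕ.+ s) (suc H)

    -- The term of letter t is an explicit summand because in `γ-range` the corresponding letter
    -- leads to β, and only the Z part of its term enters here.
    Z-range : ∀ t H m h → suc m ≡ t ℕ.+ suc H → Profile 1 t [] h →
      (z y t · Z t (suc H)) (suc n) + range (G m h) (suc t) H ≡ Z t H (suc n)
    γ-term : ∀ t H m h → suc m ≡ t ℕ.+ (2 ℕ.+ H) → Profile 1 t [] h →
      G m h (suc t) ≡ (z y (suc t) · Z (suc t) (suc H)) (suc n) + (z y (suc t) · γ⁺ t (suc H)) (suc n)
    γ-term t H m h e p = trans
      (term-≡ n (suc m) h 0 (suc t) {f = γ t (suc H)} (profile-zero (suc t) {h} (profile-grow t (profile-≤ t z≤n p)))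
        (at-γ t (suc H) (suc m) _ (trans e (ℕₚ.+-suc t (suc H))) (step-1+t t p)))
      (SR.distribˡ (z y (suc t)) (Z (suc t) (suc H)) (γ⁺ t (suc H)) (suc n))
    Z-range t zero          m h e p = +0 (sym (Z-0 t (suc n)))
    Z-range t (suc zero)    m h e p = begin
      zZ + (G m h (suc t) + 0ℚ)    ≡⟨ cong (λ g → zZ + (g + 0ℚ)) (γ-term t 0 m h e p) ⟩
      zZ + (a + b + 0ℚ)            ≡⟨ solve 3 (λ zZ a b → zZ :+ (a :+ b :+ con 0ℚ) := a :+ zZ :+ b) refl zZ a b ⟩
      a + zZ + b                   ≡⟨ cong (λ a → a + zZ + b) (sym (Z-0 (suc t) (suc n))) ⟩
      Z (suc t) 0 (suc n) + zZ + b ≡⟨ sym (Z-1 t (suc n)) ⟩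
      Z t 1 (suc n)                ∎
      where
      open ≡-Reasoning
      zZ = (z y t · Z t 2) (suc n)
      a = (z y (suc t) · Z (suc t) 1) (suc n)
      b = (z y (suc t) · γ⁺ t 1) (suc n)
    Z-range t (suc (suc H)) m h e p = begin
      zZ + (G m h (suc t) + R)     ≡⟨ cong (λ g → zZ + (g + R)) (γ-term t (suc H) m h e p) ⟩
      zZ + (a + b + R)             ≡⟨ solve 4 (λ zZ a b R → zZ :+ (a :+ b :+ R) := zZ :+ b :+ (a :+ R)) refl zZ a b R ⟩
      zZ + b + (a + R)             ≡⟨ cong ((zZ + b) +_) (δ-range t H m h (trans e (trans (ℕₚ.+-suc t (2 ℕ.+ H)) (cong suc (ℕₚ.+-suc t (suc H))))) (profile-≤ t z≤n p)) ⟩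
      zZ + b + (Z′ + d)            ≡⟨ solve 4 (λ zZ b Z′ d → zZ :+ b :+ (Z′ :+ d) := Z′ :+ zZ :+ b :+ d) refl zZ b Z′ d ⟩
      Z′ + zZ + b + d              ≡⟨ sym (Z-suc t H (suc n)) ⟩
      Z t (2 ℕ.+ H) (suc n)        ∎
      where
      open ≡-Reasoning
      zZ = (z y t · Z t (3 ℕ.+ H)) (suc n)
      a = (z y (suc t) · Z (suc t) (2 ℕ.+ H)) (suc n)
      b = (z y (suc t) · γ⁺ t (2 ℕ.+ H)) (suc n)
      d = (z y (2 ℕ.+ t) · (z y t · V (3 ℕ.+ t) (suc H))) (suc n)
      Z′ = Z (suc t) (suc H) (suc n)
      R = range (G m h) (2 ℕ.+ t) (suc H)

    α-range : ∀ t H m h → suc m ≡ t ℕ.+ suc H → Profile 2 t [] h → range (G m h) t (suc H) ≡ Z t H (suc n)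
    α-range t H m h e p = trans
      (cong (_+ range (G m h) (suc t) H)
        (term-≡ n (suc m) h 0 t {f = Z t (suc H)} (profile-zero t p) (at-α t (suc H) (suc m) _ e (step-t t p))))
      (Z-range t H m h e (profile-≤ t (s≤s z≤n) p))

    γ-range : ∀ s H m h → m ≡ 1 ℕ.+ s ℕ.+ H → Profile 2 s (1 ∷ []) h → range (G m h) s (2 ℕ.+ H) ≡ γ s H (suc n)
    γ-range s H m h e p = begin
      -- Letter s spends one occurrence and repeats the 1; letter s + 1 raises the 1 at s to 2.
      G m h s + (G m h (suc s) + R) ≡⟨ cong₂ (λ f g → f + (g + R))
          (term-≡ n (suc m) h 0 s {f = U₂ s H} (profile-head s p)
            (U-Extensions.at-U₂ (U-extensions n) s H (suc m) _ (cong suc e) (step-dup s p)))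
          (trans (term-≡ n (suc m) h 0 (suc s) {f = β s (suc H)} (profile-zero (suc s) {h} p₁)
            (at-β s (suc H) (suc m) _ e′ (step-1 s (profile-≤ s (s≤s z≤n) p))))
            (SR.distribˡ (z y (suc s)) (Z (1 ℕ.+ s) (suc H)) (z y s · V (2 ℕ.+ s) (suc H)) (suc n))) ⟩
      u + (a + v + R)               ≡⟨ solve 4 (λ u a v R → u :+ (a :+ v :+ R) := (a :+ R) :+ (u :+ v)) refl u a v R ⟩
      (a + R) + (u + v)             ≡⟨ cong (_+ (u + v)) (Z-range (suc s) H m h e′ p₁) ⟩
      Z (suc s) H (suc n) + (u + v) ∎
      where
      open ≡-Reasoning
      e′ = trans (cong suc e) (sym (ℕₚ.+-suc (suc s) H))
      p₁ : Profile 1 (suc s) [] h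
      p₁ = profile-absorb s ℕₚ.≤-refl (profile-≤ s (s≤s z≤n) p)
      u = (z y s · U₂ s H) (suc n)
      a = (z y (suc s) · Z (suc s) (suc H)) (suc n)
      v = (z y (suc s) · (z y s · V (2 ℕ.+ s) (suc H))) (suc n)
      R = range (G m h) (2 ℕ.+ s) H

  Z-at-0 : ∀ t H → Z t H 0 ≡ 0ℚ
  Z-at-0 t zero          = trans (Z-0 t 0) (z-zero y t (Z t 1))
  Z-at-0 t (suc zero)    = trans (Z-1 t 0) (cong₂ _+_ (cong₂ _+_ (Z-at-0 (suc t) 0) (z-zero y t (Z t 2)))
    (z-zero y (suc t) (γ⁺ t 1)))
  Z-at-0 t (suc (suc H)) = trans (Z-suc t H 0) (cong₂ _+_ (cong₂ _+_ (cong₂ _+_ (Z-at-0 (suc t) (suc H))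
    (z-zero y t (Z t (3 ℕ.+ H)))) (z-zero y (suc t) (γ⁺ t (2 ℕ.+ H)))) (z-zero y (2 ℕ.+ t) (z y t · V (3 ℕ.+ t) (suc H))))

  γ-at-0 : ∀ s H → γ s H 0 ≡ 0ℚ
  γ-at-0 s H = cong₂ _+_ (Z-at-0 (1 ℕ.+ s) H) (cong₂ _+_ (z-zero y s (U₂ s H)) (z-zero y (suc s) (z y s · V (2 ℕ.+ s) (suc H))))

  Z-extensions : ∀ n → Z-Extensions n
  Z-extensions zero = record
    { at-α = λ t H m h _ _ → sym (Z-at-0 t H)
    ; at-β = λ s H m h _ _ → sym (cong₂ _+_ (Z-at-0 (1 ℕ.+ s) H) (z-zero y s (V (2 ℕ.+ s) H)))
    ; at-γ = λ s H m h _ _ → sym (γ-at-0 s H)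
    ; at-δ = λ s H m h _ _ → sym (cong₂ _+_ (γ-at-0 (suc s) H) (z-zero y s (V (3 ℕ.+ s) H))) }
  Z-extensions (suc n) = record { at-α = α-case ; at-β = β-case ; at-γ = γ-case ; at-δ = δ-case }
    where
    IH = Z-extensions n
    α-case : ∀ t H m h → m ≡ t ℕ.+ H → Profile 3 t [] h → ext (suc n) m h 0 ≡ Z t H (suc n)
    α-case t H m h e p = trans (extensions-range n m t (suc H) h 0 ℕₚ.≤-refl p e′)
      (α-range n IH t H m h e′ (profile-≤ t (s≤s (s≤s z≤n)) p))
      where e′ = trans (cong suc e) (sym (ℕₚ.+-suc t H))
    β-case : ∀ s H m h → m ≡ 1 ℕ.+ s ℕ.+ H → Profile 3 s (2 ∷ []) h → ext (suc n) m h 0 ≡ β s H (suc n)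
    β-case s H m h e p = trans (extensions-range n m s (2 ℕ.+ H) h 0 ℕₚ.≤-refl p (trans e′ (sym (ℕₚ.+-suc s (suc H)))))
      (trans (cong₂ _+_ (V-term-at n s (2 ℕ.+ s) H (suc m) h 0 (profile-head s p) refl (cong suc e) (step-below′ s {h} p₁))
                        (α-range n IH (suc s) H m h e′ p₁))
             (ℚₚ.+-comm ((z y s · V (2 ℕ.+ s) H) (suc n)) (Z (1 ℕ.+ s) H (suc n))))
      where
      e′ = trans (cong suc e) (sym (ℕₚ.+-suc (suc s) H))
      p₁ : Profile 2 (suc s) [] h
      p₁ = profile-absorb s ℕₚ.≤-refl (profile-≤ s (s≤s (s≤s z≤n)) p)
    γ-case : ∀ s H m h → m ≡ 1 ℕ.+ s ℕ.+ H → Profile 3 s (1 ∷ []) h → ext (suc n) m h 0 ≡ γ s H (suc n)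
    γ-case s H m h e p = trans
      (extensions-range n m s (2 ℕ.+ H) h 0 ℕₚ.≤-refl p
        (trans (cong suc e) (trans (sym (ℕₚ.+-suc (suc s) H)) (sym (ℕₚ.+-suc s (suc H))))))
      (γ-range n IH s H m h e (profile-≤ s (s≤s (s≤s z≤n)) p))
    δ-case : ∀ s H m h → m ≡ 2 ℕ.+ s ℕ.+ H → Profile 3 s (2 ∷ 1 ∷ []) h → ext (suc n) m h 0 ≡ δ s H (suc n)
    δ-case s H m h e p = trans
      (extensions-range n m s (3 ℕ.+ H) h 0 ℕₚ.≤-refl p
        (trans (cong suc e) (trans (cong (2 ℕ.+_) (sym (ℕₚ.+-suc s H))) (trans (cong suc (sym (ℕₚ.+-suc s (suc H)))) (sym (ℕₚ.+-suc s (2 ℕ.+ H)))))))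
      (trans (cong₂ _+_ (V-term-at n s (3 ℕ.+ s) H (suc m) h 0 (profile-head s p) refl (cong suc e) (step-below″ s {h} p₂))
                        (γ-range n IH (suc s) H m h e p₁))
             (ℚₚ.+-comm ((z y s · V (3 ℕ.+ s) H) (suc n)) (γ (1 ℕ.+ s) H (suc n))))
      where
      p₁ : Profile 2 (suc s) (1 ∷ []) h
      p₁ = profile-absorb s ℕₚ.≤-refl (profile-≤ s (s≤s (s≤s z≤n)) p)
      p₂ : Profile 1 (2 ℕ.+ s) [] h
      p₂ = profile-absorb (suc s) {h = h} ℕₚ.≤-refl (profile-≤ (suc s) {h = h} (s≤s z≤n) p₁)

  -- The start is the empty permutation: t = H = 0, with no position below t to bound.
  system-solution : ∀ n → ext n 0 (λ _ → 0) 0 ≡ Z 0 0 n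
  system-solution n = Z-Extensions.at-α (Z-extensions n) 0 0 0 (λ _ → 0) refl (λ _ → refl)

-- Square roots and the generating functions

module CF = ClosedForms series-ring integer
open CF using (1-4)

sumTo-suc : ∀ F n → sumTo F (suc n) ≡ F 0 + sumTo (F ∘ suc) n
sumTo-suc F zero    = refl
sumTo-suc F (suc n) = trans (cong (_+ F (suc (suc n))) (sumTo-suc F n)) (ℚₚ.+-assoc (F 0) _ _)

⊛-· : ∀ f g → f ⊛ g ≐ f · g
⊛-· f g zero    = refl
⊛-· f g (suc n) = trans (sumTo-suc (λ i → f i * g (suc n ∸ i)) n) (cong (λ a → f 0 * g (suc n) + a) (⊛-· (tail f) g n))

poly-eval : ∀ as → poly as ≐ CF.evalPoly as x
poly-eval []       n       = sym (const-0 n)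
poly-eval (a ∷ as) zero    = sym (trans (cong (fromℤ a +_) (x-·-zero (CF.evalPoly as x)))
  (trans (ℚₚ.+-identityʳ (fromℤ a)) (sym (ℚₚ.↥p/↧p≡p (fromℤ a)))))
poly-eval (a ∷ as) (suc n) = sym (trans (ℚₚ.+-identityˡ _) (trans (x-·-suc (CF.evalPoly as x) n) (sym (poly-eval as n))))

-- Differential equations for `A` and `B`

ι : ℕ → ℚ
ι n = fromℤ (ℤ.+ n)

ι-+ : ∀ m n → ι (m ℕ.+ n) ≡ ι m + ι n
ι-+ m n = fromℤ-+ (ℤ.+ m) (ℤ.+ n)

-- The derivation x d/dx, chosen over d/dx because it does not shift coefficients.
θ : Series → Series
θ f n = ι n * f n

θ-tail : ∀ f → tail (θ f) ≐ θ (tail f) ⊕ tail f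
θ-tail f n = trans (cong (_* f (suc n)) (ι-+ 1 n))
  (solve 2 (λ k a → (con 1ℚ :+ k) :* a := k :* a :+ a) refl (ι n) (f (suc n)))

θ-· : ∀ f g → θ (f · g) ≐ θ f · g ⊕ f · θ g
θ-· f g zero    = solve 2 (λ a b → con 0ℚ :* (a :* b) := con 0ℚ :* a :* b :+ a :* (con 0ℚ :* b)) refl (f 0) (g 0)
θ-· f g (suc n) = begin
  k * (f 0 * g (suc n) + h)
    ≡⟨ cong (λ k → k * (f 0 * g (suc n) + h)) (ι-+ 1 n) ⟩
  (1ℚ + ι n) * (f 0 * g (suc n) + h)
    ≡⟨ solve 4 (λ k a b h → (con 1ℚ :+ k) :* (a :* b :+ h) := (a :* ((con 1ℚ :+ k) :* b)) :+ (k :* h :+ h)) refl (ι n) (f 0) (g (suc n)) h ⟩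
  f 0 * ((1ℚ + ι n) * g (suc n)) + (ι n * h + h)
    ≡⟨ cong₂ (λ k a → f 0 * (k * g (suc n)) + (a + h)) (sym (ι-+ 1 n)) (θ-· (tail f) g n) ⟩
  f 0 * (k * g (suc n)) + ((θ (tail f) · g) n + (tail f · θ g) n + h)
    -- The vanishing summand that appears is the constant coefficient of `θ f` times a coefficient
    -- of g.
    ≡⟨ solve 6 (λ a b p q h z → a :* b :+ (p :+ q :+ h) := (con 0ℚ :* a :* z :+ (p :+ h)) :+ (a :* b :+ q)) refl
         (f 0) (k * g (suc n)) ((θ (tail f) · g) n) ((tail f · θ g) n) h (g (suc n)) ⟩
  (0ℚ * f 0 * g (suc n) + ((θ (tail f) · g) n + h)) + (f 0 * (k * g (suc n)) + (tail f · θ g) n)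
    ≡⟨ cong (λ a → (0ℚ * f 0 * g (suc n) + a) + (f 0 * (k * g (suc n)) + (tail f · θ g) n))
         (sym (trans (·-cong {g = g} (θ-tail f) (λ _ → refl) n) (·-distribʳ g (θ (tail f)) (tail f) n))) ⟩
  (θ f · g ⊕ f · θ g) (suc n) ∎
  where
  open ≡-Reasoning
  k = ι (suc n)
  h = (tail f · g) n

ι-inverse : ∀ n → (ℤ.+ 1) / suc n * ι (suc n) ≡ 1ℚ
ι-inverse n = trans (cong (_* ι (suc n)) (ℚₚ.↥p/↧p≡p (1/ ι (suc n)))) (ℚₚ.*-inverseˡ (ι (suc n)))

-- Characteristic zero enters here, through division by n + 1.
θ-zero : ∀ f → θ f ≐ const 0ℚ → f ≐ const (f 0)
θ-zero f e zero    = refl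
θ-zero f e (suc n) = begin
  f (suc n)                              ≡⟨ sym (ℚₚ.*-identityˡ (f (suc n))) ⟩
  1ℚ * f (suc n)                         ≡⟨ cong (_* f (suc n)) (sym (ι-inverse n)) ⟩
  (ℤ.+ 1) / suc n * ι (suc n) * f (suc n) ≡⟨ ℚₚ.*-assoc ((ℤ.+ 1) / suc n) (ι (suc n)) (f (suc n)) ⟩
  (ℤ.+ 1) / suc n * (ι (suc n) * f (suc n)) ≡⟨ cong ((ℤ.+ 1) / suc n *_) (e (suc n)) ⟩
  (ℤ.+ 1) / suc n * 0ℚ                   ≡⟨ ℚₚ.*-zeroʳ ((ℤ.+ 1) / suc n) ⟩
  0ℚ                                     ∎
  where open ≡-Reasoning

-- The ratio of consecutive terms of the binomial series: -4 (α - k) = 4k + 6 for α = -3/2.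
A-rec : ∀ k → ι (suc k) * A (suc k) ≡ (ι 4 * ι k + ι 6) * A k
A-rec k = begin
  ι (suc k) * (g * (α - (ℤ.+ k) / 1) * r * (p * c))
    ≡⟨ cong (λ κ → ι (suc k) * (g * (α - κ) * r * (p * c))) (ℚₚ.↥p/↧p≡p (ι k)) ⟩
  ι (suc k) * (g * (α - ι k) * r * (p * c))
    ≡⟨ solve 5 (λ g p r ι′ κ → ι′ :* (g :* (con α :- κ) :* r :* (p :* con c)) := (r :* ι′) :* ((con (ι 4) :* κ :+ con (ι 6)) :* (g :* p)))
         refl g p r (ι (suc k)) (ι k) ⟩
  (r * ι (suc k)) * ((ι 4 * ι k + ι 6) * (g * p))
    ≡⟨ trans (cong (_* ((ι 4 * ι k + ι 6) * (g * p))) (ι-inverse k)) (ℚₚ.*-identityˡ _) ⟩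
  (ι 4 * ι k + ι 6) * (g * p) ∎
  where
  open ≡-Reasoning
  α = neg 3 / 2
  c = neg 4 / 1
  g = gbinom α k
  p = c ^ℚ k
  r = (ℤ.+ 1) / suc k

even-half : ∀ n → isEven n ≡ true → n ≡ ⌊ n /2⌋ ℕ.+ ⌊ n /2⌋
even-half zero          _ = refl
even-half (suc (suc n)) e = cong suc (trans (cong suc (even-half n (trans (sym (not-involutive (isEven n))) e))) (sym (ℕₚ.+-suc ⌊ n /2⌋ ⌊ n /2⌋)))

-- For odd n both sides vanish; for n = 2m this is twice the recurrence of `A` at m.
B-rec : ∀ n → ι (2 ℕ.+ n) * B (2 ℕ.+ n) ≡ (ι 4 * ι n + ι 12) * B n
B-rec n with isEven n in even
... | false = trans (ℚₚ.*-zeroʳ (ι (2 ℕ.+ n))) (sym (ℚₚ.*-zeroʳ (ι 4 * ι n + ι 12)))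
... | true  = begin
  ι (2 ℕ.+ n) * A (suc m)
    ≡⟨ cong (_* A (suc m)) (trans (ι-+ 2 n) (cong (ι 2 +_) ιn)) ⟩
  (ι 2 + (ι m + ι m)) * A (suc m)
    ≡⟨ solve 2 (λ m a → (con (ι 2) :+ (m :+ m)) :* a := con (ι 2) :* ((con 1ℚ :+ m) :* a)) refl (ι m) (A (suc m)) ⟩
  ι 2 * ((1ℚ + ι m) * A (suc m))
    ≡⟨ cong (λ a → ι 2 * a) (trans (cong (_* A (suc m)) (sym (ι-+ 1 m))) (A-rec m)) ⟩
  ι 2 * ((ι 4 * ι m + ι 6) * A m)
    ≡⟨ solve 2 (λ m a → con (ι 2) :* ((con (ι 4) :* m :+ con (ι 6)) :* a) := (con (ι 4) :* (m :+ m) :+ con (ι 12)) :* a) refl (ι m) (A m) ⟩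
  (ι 4 * (ι m + ι m) + ι 12) * A m
    ≡⟨ cong (λ k → (ι 4 * k + ι 12) * A m) (sym ιn) ⟩
  (ι 4 * ι n + ι 12) * A m ∎
  where
  open ≡-Reasoning
  m = ⌊ n /2⌋
  ιn : ι n ≡ ι m + ι m
  ιn = trans (cong ι (even-half n even)) (ι-+ m m)

c : ℤ → Series
c a = const (fromℤ a)

ode-coeff : ∀ a b (f : Series) n → (c (ℤ.+ 4) · θ f ⊕ (c a · c b) · f) n ≡ (ι 4 * ι n + fromℤ a * fromℤ b) * f n
ode-coeff a b f n = begin
  (c (ℤ.+ 4) · θ f) n + ((c a · c b) · f) n
    ≡⟨ cong₂ _+_ (const-· (ι 4) (θ f) n) (trans (·-assoc (c a) (c b) f n) (trans (const-· (fromℤ a) (c b · f) n) (cong (fromℤ a *_) (const-· (fromℤ b) f n)))) ⟩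
  ι 4 * (ι n * f n) + fromℤ a * (fromℤ b * f n)
    ≡⟨ solve 5 (λ k n a b f → k :* (n :* f) :+ a :* (b :* f) := (k :* n :+ a :* b) :* f) refl (ι 4) (ι n) (fromℤ a) (fromℤ b) (f n) ⟩
  (ι 4 * ι n + fromℤ a * fromℤ b) * f n ∎
  where open ≡-Reasoning

A-ode : θ A ≐ x · (c (ℤ.+ 4) · θ A ⊕ (c (ℤ.+ 6) · c (ℤ.+ 1)) · A)
A-ode zero    = refl
A-ode (suc n) = sym (trans (x-·-suc (c (ℤ.+ 4) · θ A ⊕ (c (ℤ.+ 6) · c (ℤ.+ 1)) · A) n) (trans (ode-coeff (ℤ.+ 6) (ℤ.+ 1) A n) (sym (A-rec n))))

B-ode : θ B ≐ (x · x) · (c (ℤ.+ 4) · θ B ⊕ (c (ℤ.+ 6) · c (ℤ.+ 2)) · B)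
B-ode n = trans (lemma n) (sym (·-assoc x x f n))
  where
  f = c (ℤ.+ 4) · θ B ⊕ (c (ℤ.+ 6) · c (ℤ.+ 2)) · B
  lemma : θ B ≐ x · (x · f)
  lemma zero          = sym (x-·-zero (x · f))
  lemma (suc zero)    = sym (trans (x-·-suc (x · f) 0) (x-·-zero f))
  lemma (suc (suc n)) = sym (trans (x-·-suc (x · f) (suc n)) (trans (x-·-suc f n) (trans (ode-coeff (ℤ.+ 6) (ℤ.+ 2) B n) (sym (B-rec n)))))

θ-const : ∀ q → θ (const q) ≐ const 0ℚ
θ-const q zero    = ℚₚ.*-zeroˡ q
θ-const q (suc n) = ℚₚ.*-zeroʳ (ι (suc n))

θ-1-4y : ∀ {y j} → θ y ≐ c j · y → θ (1-4 y) ≐ ⊖ (c (ℤ.+ 4) · (c j · y))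
θ-1-4y {y} {j} e n = begin
  ι n * (c (ℤ.+ 1) n + - (c (ℤ.+ 4) · y) n)
    ≡⟨ cong (λ a → ι n * (c (ℤ.+ 1) n + - a)) (const-· (ι 4) y n) ⟩
  ι n * (c (ℤ.+ 1) n + - (ι 4 * y n))
    ≡⟨ solve 4 (λ k a b y → k :* (a :+ :- (b :* y)) := k :* a :+ :- (b :* (k :* y))) refl (ι n) (c (ℤ.+ 1) n) (ι 4) (y n) ⟩
  ι n * c (ℤ.+ 1) n + - (ι 4 * (ι n * y n))
    ≡⟨ cong₂ (λ a b → a + - (ι 4 * b)) (trans (θ-const (ι 1) n) (const-0 n)) (e n) ⟩
  0ℚ + - (ι 4 * (c j · y) n)
    ≡⟨ trans (ℚₚ.+-identityˡ _) (cong -_ (sym (const-· (ι 4) (c j · y) n))) ⟩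
  - (c (ℤ.+ 4) · (c j · y)) n ∎
  where open ≡-Reasoning

θ-x : θ x ≐ c (ℤ.+ 1) · x
θ-x n = trans (lemma n) (sym (const-· (ι 1) x n))
  where
  lemma : ∀ n → ι n * x n ≡ ι 1 * x n
  lemma zero          = refl
  lemma (suc zero)    = refl
  lemma (suc (suc n)) = trans (ℚₚ.*-zeroʳ (ι (suc (suc n)))) (sym (ℚₚ.*-zeroʳ (ι 1)))

θ-x² : θ (x · x) ≐ c (ℤ.+ 2) · (x · x)
θ-x² n = begin
  θ (x · x) n                      ≡⟨ θ-· x x n ⟩
  (θ x · x) n + (x · θ x) n        ≡⟨ cong₂ _+_ (·-cong {g = x} θ-x (λ _ → refl) n) (trans (·-comm x (θ x) n) (·-cong {g = x} θ-x (λ _ → refl) n)) ⟩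
  ((c (ℤ.+ 1) · x) · x) n + ((c (ℤ.+ 1) · x) · x) n
    ≡⟨ cong (λ a → a + a) (trans (·-assoc (c (ℤ.+ 1)) x x n) (const-· (ι 1) (x · x) n)) ⟩
  ι 1 * (x · x) n + ι 1 * (x · x) n ≡⟨ solve 1 (λ a → con (ι 1) :* a :+ con (ι 1) :* a := con (ι 2) :* a) refl ((x · x) n) ⟩
  ι 2 * (x · x) n                  ≡⟨ sym (const-· (ι 2) (x · x) n) ⟩
  (c (ℤ.+ 2) · (x · x)) n          ∎
  where open ≡-Reasoning

-- The product is constant by `θ-zero`, and its constant coefficient computes to 1.
A-root : A · A · ((1-4 x) · ((1-4 x) · (1-4 x))) ≐ const 1ℚ
A-root = θ-zero (A · A · ((1-4 x) · ((1-4 x) · (1-4 x)))) (CF.derivation-root θ θ-· A (1-4 x)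
  (CF.ode {x} {1-4 x} {A} {θ (1-4 x)} {θ A} {c (ℤ.+ 1)} (λ _ → refl) (θ-1-4y {x} {ℤ.+ 1} θ-x) A-ode))

B-root : B · B · ((1-4 (x · x)) · ((1-4 (x · x)) · (1-4 (x · x)))) ≐ const 1ℚ
B-root = θ-zero (B · B · ((1-4 (x · x)) · ((1-4 (x · x)) · (1-4 (x · x))))) (CF.derivation-root θ θ-· B (1-4 (x · x))
  (CF.ode {x · x} {1-4 (x · x)} {B} {θ (1-4 (x · x))} {θ B} {c (ℤ.+ 2)} (λ _ → refl) (θ-1-4y {x · x} {ℤ.+ 2} θ-x²) B-ode))

-- The algebraic series C and b

cancel-4x : ∀ f → c (ℤ.+ 4) · (x · f) ≐ const 0ℚ → f ≐ const 0ℚ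
cancel-4x f e n = trans (begin
  f n                         ≡⟨ solve 1 (λ a → a := con quarter :* (con (ι 4) :* a)) refl (f n) ⟩
  quarter * (ι 4 * f n)       ≡⟨ cong (λ a → quarter * (ι 4 * a)) (sym (x-·-suc f n)) ⟩
  quarter * (ι 4 * (x · f) (suc n)) ≡⟨ cong (quarter *_) (trans (sym (const-· (ι 4) (x · f) (suc n))) (e (suc n))) ⟩
  quarter * 0ℚ                ≡⟨ ℚₚ.*-zeroʳ quarter ⟩
  0ℚ                          ∎) (sym (const-0 n))
  where open ≡-Reasoning

-- This is (1 - f) / (2x) when f has constant coefficient 1. It yields C, the Catalan series, from
-- `S`, and b from `T`.
halfTail : Series → Series
halfTail f = scale (- half) (tail f)

halfTail-spec : ∀ f → f 0 ≡ 1ℚ → c (ℤ.+ 1) ⊕ ⊖ (c (ℤ.+ 2) · (x · halfTail f)) ≐ f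
halfTail-spec f e n = trans (cong (λ a → c (ℤ.+ 1) n + - a) (const-· (ι 2) (x · halfTail f) n)) (lemma n)
  where
  lemma : ∀ n → c (ℤ.+ 1) n + - (ι 2 * (x · halfTail f) n) ≡ f n
  lemma zero    = trans (cong (λ a → ι 1 + - (ι 2 * a)) (x-·-zero (halfTail f))) (sym e)
  lemma (suc n) = trans (cong (λ a → 0ℚ + - (ι 2 * a)) (x-·-suc (halfTail f) n))
    (solve 1 (λ a → con 0ℚ :+ :- (con (ι 2) :* (con (- half) :* a)) := a) refl (f (suc n)))

S T : Series
S = A · ((1-4 x) · (1-4 x))
T = B · ((1-4 (x · x)) · (1-4 (x · x)))

half-2 : c (ℤ.+ 2) · const half ≐ const 1ℚ
half-2 zero    = refl
half-2 (suc n) = trans (const-· (ι 2) (const half) (suc n)) (ℚₚ.*-zeroʳ (ι 2))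

module UR = CF.UnsignedRoot {x} {A} {halfTail S} {const half} A-root
  half-2 (halfTail-spec S refl) cancel-4x
module SR′ = CF.SignedRoot {x} {B} {halfTail T} B-root (halfTail-spec T refl) cancel-4x

z₊ : ∀ t → z 1ℚ t · (halfTail S · halfTail S) ≐ halfTail S ⊕ ⊖ c (ℤ.+ 1)
z₊ t n = trans (·-cong {g = halfTail S · halfTail S} (z≐x t) (λ _ → refl) n) (UR.quadratic-C n)
  where
  1^ℚ : ∀ t → 1ℚ ^ℚ t ≡ 1ℚ
  1^ℚ zero    = refl
  1^ℚ (suc t) = cong (_* 1ℚ) (1^ℚ t)
  z≐x : ∀ t → z 1ℚ t ≐ x
  z≐x t n = trans (const-· (1ℚ ^ℚ t) x n) (trans (cong (_* x n) (1^ℚ t)) (ℚₚ.*-identityˡ (x n)))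

open SignedSystem series-ring integer using (sign)

z₋ : ∀ t → z (- 1ℚ) t · (c (ℤ.+ 1) ⊕ halfTail T · halfTail T) ≐ sign t (halfTail T)
z₋ zero    n = trans (·-cong {g = c (ℤ.+ 1) ⊕ halfTail T · halfTail T} (λ n → trans (const-· 1ℚ x n) (ℚₚ.*-identityˡ (x n))) (λ _ → refl) n) (SR′.quadratic-b n)
z₋ (suc t) n = begin
  (z (- 1ℚ) (suc t) · W) n        ≡⟨ ·-assoc (const (ε * - 1ℚ)) x W n ⟩
  (const (ε * - 1ℚ) · (x · W)) n  ≡⟨ const-· (ε * - 1ℚ) (x · W) n ⟩
  ε * - 1ℚ * (x · W) n            ≡⟨ solve 2 (λ e a → e :* con (- 1ℚ) :* a := :- (e :* a)) refl ε ((x · W) n) ⟩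
  - (ε * (x · W) n)               ≡⟨ cong -_ (sym (trans (·-assoc (const ε) x W n) (const-· ε (x · W) n))) ⟩
  - (z (- 1ℚ) t · W) n            ≡⟨ cong -_ (z₋ t n) ⟩
  - sign t (halfTail T) n         ∎
  where
  open ≡-Reasoning
  W = c (ℤ.+ 1) ⊕ halfTail T · halfTail T
  ε = (- 1ℚ) ^ℚ t

-- Identification of the counts and the three formulas

module US = UnsignedSystem series-ring integer
module SS = SignedSystem series-ring integer

unsigned-count : ∀ n → E2 n + 1ℚ * O2 n ≡ US.Z (halfTail S) (z 1ℚ) z₊ UR.M₀ UR.M₀≈ 0 0 n
unsigned-count n = trans (parity-sum n 1ℚ λ k → trans (1^ k) (cong (ind (isEven k) +_) (sym (ℚₚ.*-identityˡ _))))
  (Solution.system-solution 1ℚ _ _ _ (US.system (halfTail S) (z 1ℚ) z₊ UR.M₀ UR.M₀≈) n)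

signed-count : ∀ n → E2 n + - 1ℚ * O2 n ≡ SS.Z (halfTail T) (z (- 1ℚ)) z₋ SR′.M₀ SR′.M₀≈ 0 0 n
signed-count n = trans (parity-sum n (- 1ℚ) -1^)
  (Solution.system-solution (- 1ℚ) _ _ _ (SS.system (halfTail T) (z (- 1ℚ)) z₋ SR′.M₀ SR′.M₀≈) n)

-- The polynomial parts of 2 (E2 + O2) and of 2 (E2 - O2).
p₊ p₋ : List ℤ
p₊ = neg 2 ∷ ℤ.+ 3 ∷ ℤ.+ 1 ∷ []
p₋ = ℤ.+ 2 ∷ neg 5 ∷ neg 9 ∷ ℤ.+ 6 ∷ ℤ.+ 2 ∷ []

·-one : ∀ as → poly as ≐ CF.evalPoly as x · const 1ℚ
·-one as n = trans (poly-eval as n) (sym (CommutativeRing.*-identityʳ series-ring (CF.evalPoly as x) n))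

⊛-eval : ∀ as f → poly as ⊛ f ≐ CF.evalPoly as x · f
⊛-eval as f n = trans (⊛-· (poly as) f n) (·-cong {g = f} (poly-eval as) (λ _ → refl) n)

sum-formula : ∀ n → poly p₊ n + (P ⊛ A) n ≡ ι 2 * (E2 n + 1ℚ * O2 n)
sum-formula n = trans (cong₂ _+_ (·-one p₊ n) (⊛-eval (ℤ.+ 2 ∷ neg 15 ∷ ℤ.+ 29 ∷ neg 4 ∷ ℤ.+ 2 ∷ []) A n))
  (trans (UR.closed-form n) (trans (const-· (ι 2) (US.Z (halfTail S) (z 1ℚ) z₊ UR.M₀ UR.M₀≈ 0 0) n) (cong (ι 2 *_) (sym (unsigned-count n)))))

difference-formula : ∀ n → poly p₋ n - (Q ⊛ B) n ≡ ι 2 * (E2 n + - 1ℚ * O2 n)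
difference-formula n = trans (cong₂ _-_ (·-one p₋ n) (⊛-eval (ℤ.+ 2 ∷ neg 5 ∷ neg 21 ∷ ℤ.+ 36 ∷ ℤ.+ 64 ∷ neg 76 ∷ neg 48 ∷ ℤ.+ 16 ∷ []) B n))
  (trans (SR′.closed-form n) (trans (const-· (ι 2) (SS.Z (halfTail T) (z (- 1ℚ)) z₋ SR′.M₀ SR′.M₀≈ 0 0) n) (cong (ι 2 *_) (sym (signed-count n)))))

E-poly : ∀ n → half * poly (ℤ.+ 0 ∷ neg 1 ∷ neg 4 ∷ ℤ.+ 3 ∷ ℤ.+ 1 ∷ []) n ≡ quarter * (poly p₊ n + poly p₋ n)
E-poly 0 = refl
E-poly 1 = refl
E-poly 2 = refl
E-poly 3 = refl
E-poly 4 = refl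
E-poly (suc (suc (suc (suc (suc n))))) = refl

O-poly : ∀ n → - half * poly (ℤ.+ 2 ∷ neg 4 ∷ neg 5 ∷ ℤ.+ 3 ∷ ℤ.+ 1 ∷ []) n ≡ quarter * (poly p₊ n - poly p₋ n)
O-poly 0 = refl
O-poly 1 = refl
O-poly 2 = refl
O-poly 3 = refl
O-poly 4 = refl
O-poly (suc (suc (suc (suc (suc n))))) = refl

theorem6 : ((n : ℕ) → E2 n ≡ E2rhs n)
    × ((n : ℕ) → O2 n ≡ O2rhs n)
    × ((n : ℕ) → F2 n ≡ F2rhs n)
theorem6 = E-formula , O-formula , F-formula
  where
  open ≡-Reasoning
  module _ (n : ℕ) where
    e = E2 n
    o = O2 n
    p = poly p₊ n
    m = poly p₋ n
    pa = (P ⊛ A) n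
    qb = (Q ⊛ B) n

    E-formula : e ≡ E2rhs n
    E-formula = sym (begin
      E2rhs n ≡⟨ cong (_+ (quarter * pa + - quarter * qb)) (E-poly n) ⟩
      quarter * (p + m) + (quarter * pa + - quarter * qb)
        ≡⟨ solve 4 (λ p m a b → con quarter :* (p :+ m) :+ (con quarter :* a :+ con (- quarter) :* b) := con quarter :* ((p :+ a) :+ (m :- b))) refl p m pa qb ⟩
      quarter * ((p + pa) + (m - qb)) ≡⟨ cong₂ (λ a b → quarter * (a + b)) (sum-formula n) (difference-formula n) ⟩
      quarter * (ι 2 * (e + 1ℚ * o) + ι 2 * (e + - 1ℚ * o))
        ≡⟨ solve 2 (λ e o → con quarter :* (con (ι 2) :* (e :+ con 1ℚ :* o) :+ con (ι 2) :* (e :+ con (- 1ℚ) :* o)) := e) refl e o ⟩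
      e ∎)

    O-formula : o ≡ O2rhs n
    O-formula = sym (begin
      O2rhs n ≡⟨ cong (_+ (quarter * pa + quarter * qb)) (O-poly n) ⟩
      quarter * (p - m) + (quarter * pa + quarter * qb)
        ≡⟨ solve 4 (λ p m a b → con quarter :* (p :- m) :+ (con quarter :* a :+ con quarter :* b) := con quarter :* ((p :+ a) :- (m :- b))) refl p m pa qb ⟩
      quarter * ((p + pa) - (m - qb)) ≡⟨ cong₂ (λ a b → quarter * (a - b)) (sum-formula n) (difference-formula n) ⟩
      quarter * (ι 2 * (e + 1ℚ * o) - ι 2 * (e + - 1ℚ * o))
        ≡⟨ solve 2 (λ e o → con quarter :* (con (ι 2) :* (e :+ con 1ℚ :* o) :- con (ι 2) :* (e :+ con (- 1ℚ) :* o)) := o) refl e o ⟩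
      o ∎)

    F-formula : e + o ≡ F2rhs n
    F-formula = sym (begin
      half * p + half * pa ≡⟨ sym (ℚₚ.*-distribˡ-+ half p pa) ⟩
      half * (p + pa) ≡⟨ cong (half *_) (sum-formula n) ⟩
      half * (ι 2 * (e + 1ℚ * o))
        ≡⟨ solve 2 (λ e o → con half :* (con (ι 2) :* (e :+ con 1ℚ :* o)) := e :+ o) refl e o ⟩
      e + o ∎)
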